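{- Let $(\mathbf A,G,H)$ be a tense Pavelka algebra whose underlying Pavelka algebra $\mathbf A$ is semisimple. The following are equivalent: (i) $G(x)\cdot G(y)\le G(x\cdot y)$ for all $x,y\in A$; (ii) $H(x)\cdot H(y)\le H(x\cdot y)$ for all $x,y\in A$; (iii) the natural time frame of $(\mathbf A,G,H)$ is boolean, i.e. $R(F,F')=\bigwedge_{a\in A}(G(a)/F'\rightarrow a/F)\in\{0,1\}$ for all $F,F'\in\mathrm{Spec_M}\mathbf A$; (iv) $G$ and $H$ are tense operators on the MV-reduct $(A;\oplus,\neg,\mathbf 0)$ in the sense of tense MV-algebras, i.e. for all $x,y\in A$: (T1) $G(1)=H(1)=1$; (T2) $G(x)\cdot G(y)\le G(x\cdot y)$, $H(x)\cdot H(y)\le H(x\cdot y)$; (T3) $G(x)\oplus G(y)\le G(x\oplus y)$, $H(x)\oplus H(y)\le H(x\oplus y)$; (T4) $G(x)\cdot G(x)=G(x\cdot x)$, $H(x)\cdot H(x)=H(x\cdot x)$; (T5) $G(x)\oplus G(x)=G(x\oplus x)$, $H(x)\oplus H(x)=H(x\oplus x)$; (T6) $\neg G(\neg H(x))\le x$, $\neg H(\neg G(x))\le x$.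
   Context: An MV-algebra $(A;\oplus,\neg,0)$ carries derived operations $1=\neg0$, $x\cdot y=\neg(\neg x\oplus\neg y)$, $x\rightarrow y=\neg x\oplus y$, $x\vee y=\neg(\neg x\oplus y)\oplus y$, $x\wedge y=\neg(\neg x\vee\neg y)$, order $x\le y$ iff $\neg x\oplus y=1$. The standard MV-algebra is $[0,1]$ with $x\oplus y=\min\{x+y,1\}$, $\neg x=1-x$. A Pavelka algebra is $\mathbf A=(A;\oplus,\neg,\{\mathbf r\mid r\in[0,1]\cap\mathbb Q\})$ with $(A;\oplus,\neg,\mathbf 0)$ an MV-algebra, $\mathbf r\oplus\mathbf s=\mathbf t$ whenever $\min\{r+s,1\}=t$, $\neg\mathbf r=\mathbf s$ whenever $1-r=s$. Filters are filters of the MV-reduct; $\mathrm{Spec_M}\mathbf A$ is the set of maximal proper filters; for $F\in\mathrm{Spec_M}\mathbf A$, $\mathbf A/F$ embeds uniquely into $[0,1]$ and $x/F$ is identified with its image in $[0,1]$. Semisimple: MV-reduct is a subdirect product of simple MV-algebras. A tense Pavelka algebra is $(\mathbf A,G,H)$ with $G,H\colon A\to A$ such that for all $x,y$ and constants $\mathbf r$: (PT1) $G(x\wedge y)=G(x)\wedge G(y)$, $H(x\wedge y)=H(x)\wedge H(y)$; (PT2) $\mathbf r\rightarrow G(x)=G(\mathbf r\rightarrow x)$, $\mathbf r\rightarrow H(x)=H(\mathbf r\rightarrow x)$; (PT3) $\neg H(\neg G(x))\le x$, $\neg G(\neg H(x))\le x$. -}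

module Defs where

open import Level using (Level; _⊔_; Lift; lift; lower) renaming (suc to lsuc)
open import Algebra.Structures using (IsCommutativeMonoid)
open import Algebra.Morphism.Definitions using (Homomorphic₀; Homomorphic₁; Homomorphic₂)
open import Data.Product using (_×_; _,_; proj₁; proj₂; ∃-syntax)
open import Data.Rational using (ℚ; 0ℚ; 1ℚ; ½)
open import Data.Rational.Properties using (<-dense; <-trans; <-≤-trans; ≤-<-trans; <⇒≤; ≮⇒≥; <-irrefl; positive⁻¹)
open import Data.Sum using (_⊎_)
open import Function.Definitions using (Congruent; Injective; Surjective)
open import Relation.Binary.Bundles using (Poset)
open import Relation.Binary.Core using (Rel)
open import Relation.Binary.Structures using (IsEquivalence)
open import Relation.Binary.PropositionalEquality using (_≡_; refl; sym; subst)
open import Relation.Nullary using (¬_)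
open import Relation.Unary using (Pred; _∈_; _∉_; _⊆_)
import Data.Rational as ℚ
import Data.Rational.Properties as ℚₚ

-- Together with excluded middle this supplies the classical set theory
-- in which maximal filters are studied.

ZornsLemma : ∀ c ℓ₁ ℓ₂ p → Set (lsuc (c ⊔ ℓ₁ ⊔ ℓ₂ ⊔ p))
ZornsLemma c ℓ₁ ℓ₂ p = (P : Poset c ℓ₁ ℓ₂) → let open Poset P in
  ((C : Pred Carrier p) →
    (∀ {x y} → x ∈ C → y ∈ C → (x ≤ y) ⊎ (y ≤ x)) →
    ∃[ u ] (∀ {x} → x ∈ C → x ≤ u)) →
  ∃[ m ] (∀ {x} → m ≤ x → x ≈ m)

record RawMV c ℓ : Set (lsuc (c ⊔ ℓ)) where
  infix  8 ∼_
  infixl 7 _·_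
  infixl 6 _⊕_ _∧_ _∨_
  infixr 5 _⇒_
  infix  4 _≈_ _≤_
  field
    Carrier : Set c
    _≈_     : Rel Carrier ℓ
    _⊕_     : Carrier → Carrier → Carrier
    ∼_      : Carrier → Carrier
    𝟎       : Carrier

  𝟏 : Carrier
  𝟏 = ∼ 𝟎

  _·_ _⇒_ _∨_ _∧_ : Carrier → Carrier → Carrier
  x · y = ∼ (∼ x ⊕ ∼ y)
  x ⇒ y = ∼ x ⊕ y
  x ∨ y = ∼ (∼ x ⊕ y) ⊕ y
  x ∧ y = ∼ (∼ x ∨ ∼ y)

  _≤_ : Rel Carrier ℓ
  x ≤ y = ∼ x ⊕ y ≈ 𝟏

record MVAlgebra c ℓ : Set (lsuc (c ⊔ ℓ)) where
  field
    raw : RawMV c ℓ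
  open RawMV raw public
  field
    ⊕-isCommutativeMonoid : IsCommutativeMonoid _≈_ _⊕_ 𝟎
    ∼-cong                : Congruent _≈_ _≈_ ∼_
    ∼-involutive          : ∀ x → ∼ ∼ x ≈ x
    ⊕-zeroʳ               : ∀ x → x ⊕ 𝟏 ≈ 𝟏
    ∨-comm                : ∀ x y → ∼ (∼ x ⊕ y) ⊕ y ≈ ∼ (∼ y ⊕ x) ⊕ x

record MVHomomorphism {a b c d} (A : RawMV a b) (B : RawMV c d) : Set (a ⊔ b ⊔ c ⊔ d) where
  private
    module A = RawMV A
    module B = RawMV B
  field
    ⟦_⟧    : A.Carrier → B.Carrier
    ⟦⟧-cong : Congruent A._≈_ B._≈_ ⟦_⟧
    ⊕-homo : Homomorphic₂ A.Carrier B.Carrier B._≈_ ⟦_⟧ A._⊕_ B._⊕_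
    ∼-homo : Homomorphic₁ A.Carrier B.Carrier B._≈_ ⟦_⟧ A.∼_ B.∼_
    𝟎-homo : Homomorphic₀ A.Carrier B.Carrier B._≈_ ⟦_⟧ A.𝟎 B.𝟎

record MVEmbedding {a b c d} (A : RawMV a b) (B : RawMV c d) : Set (a ⊔ b ⊔ c ⊔ d) where
  field
    homomorphism : MVHomomorphism A B
  open MVHomomorphism homomorphism public
  field
    injective : Injective (RawMV._≈_ A) (RawMV._≈_ B) ⟦_⟧

record IsMVCongruence {c ℓ} (A : MVAlgebra c ℓ) (θ : Rel (MVAlgebra.Carrier A) (c ⊔ ℓ)) : Set (c ⊔ ℓ) where
  open MVAlgebra A
  field
    isEquivalence : IsEquivalence θ
    ≈⇒θ           : ∀ {x y} → x ≈ y → θ x y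
    ⊕-compatible  : ∀ {x x′ y y′} → θ x x′ → θ y y′ → θ (x ⊕ y) (x′ ⊕ y′)
    ∼-compatible  : ∀ {x x′} → θ x x′ → θ (∼ x) (∼ x′)

record IsSimple {c ℓ} (A : MVAlgebra c ℓ) : Set (lsuc (c ⊔ ℓ)) where
  open MVAlgebra A
  field
    nontrivial  : ¬ (𝟎 ≈ 𝟏)
    congruences : ∀ θ → IsMVCongruence A θ →
                  (∀ x y → θ x y → x ≈ y) ⊎ (∀ x y → θ x y)

-- A subdirect product of simple algebras; the index set and the factors may
-- live in universes unrelated to that of A.

record IsSemisimple {c ℓ} i s t (A : MVAlgebra c ℓ) : Set (c ⊔ ℓ ⊔ lsuc (i ⊔ s ⊔ t)) where
  private module A = MVAlgebra A
  field
    Index      : Set i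
    factor     : Index → MVAlgebra s t
    simple     : ∀ j → IsSimple (factor j)
    projection : ∀ j → MVHomomorphism A.raw (MVAlgebra.raw (factor j))

  private
    π : ∀ j → A.Carrier → MVAlgebra.Carrier (factor j)
    π j = MVHomomorphism.⟦_⟧ (projection j)

  field
    surjective : ∀ j → Surjective A._≈_ (MVAlgebra._≈_ (factor j)) (π j)
    separating : ∀ {x y} → (∀ j → MVAlgebra._≈_ (factor j) (π j x) (π j y)) → x A.≈ y

module _ {c ℓ} (A : MVAlgebra c ℓ) where
  open MVAlgebra A

  record IsFilter (F : Pred Carrier (c ⊔ ℓ)) : Set (c ⊔ ℓ) where
    field
      𝟏∈       : 𝟏 ∈ F
      ·-closed : ∀ {x y} → x ∈ F → y ∈ F → x · y ∈ F
      upward   : ∀ {x y} → x ≤ y → x ∈ F → y ∈ F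

  record IsProperFilter (F : Pred Carrier (c ⊔ ℓ)) : Set (c ⊔ ℓ) where
    field
      isFilter : IsFilter F
      proper   : 𝟎 ∉ F

  record SpecM : Set (lsuc (c ⊔ ℓ)) where
    field
      filter         : Pred Carrier (c ⊔ ℓ)
      isProperFilter : IsProperFilter filter
      maximal        : ∀ F → IsProperFilter F → filter ⊆ F → F ⊆ filter

  infixl 7 _/_

  _/_ : Pred Carrier (c ⊔ ℓ) → RawMV c (c ⊔ ℓ)
  _/_ F = record
    { Carrier = Carrier
    ; _≈_     = λ x y → (x ⇒ y ∈ F) × (y ⇒ x ∈ F)
    ; _⊕_     = _⊕_
    ; ∼_      = ∼_
    ; 𝟎       = 𝟎
    }

-- A real x ∈ [0,1] is given by its Dedekind cut {q ∈ ℚ | q < x}.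

record 𝕀 ℓ : Set (lsuc ℓ) where
  field
    cut      : Pred ℚ ℓ
    negative : ∀ {q} → q ℚ.< 0ℚ → q ∈ cut
    bounded  : ∀ {q} → q ∈ cut → q ℚ.< 1ℚ
    downward : ∀ {p q} → p ℚ.< q → q ∈ cut → p ∈ cut
    open-cut : ∀ {q} → q ∈ cut → ∃[ r ] (q ℚ.< r × r ∈ cut)

open 𝕀 public

private
  0<1 : 0ℚ ℚ.< 1ℚ
  0<1 = positive⁻¹ 1ℚ

  halves : ∀ q → ½ ℚ.* q ℚ.+ ½ ℚ.* q ≡ q
  halves q = subst (_≡ q) (ℚₚ.*-distribʳ-+ q ½ ½) (ℚₚ.*-identityˡ q)

  half-negative : ∀ {q} → q ℚ.< 0ℚ → ½ ℚ.* q ℚ.< 0ℚ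
  half-negative q<0 = ℚₚ.*-monoʳ-<-pos ½ q<0

  1-r≮0⇒r≤1 : ∀ {r} → ¬ (1ℚ ℚ.- r ℚ.< 0ℚ) → r ℚ.≤ 1ℚ
  1-r≮0⇒r≤1 {r} h = ≮⇒≥ λ 1<r →
    h (subst (1ℚ ℚ.- r ℚ.<_) (ℚₚ.+-inverseʳ r) (ℚₚ.+-monoˡ-< (ℚ.- r) 1<r))

module _ {ℓ : Level} where

  infix 4 _≤ᵢ_ _≈ᵢ_

  _≤ᵢ_ _≈ᵢ_ : Rel (𝕀 ℓ) ℓ
  x ≤ᵢ y = ∀ {q} → q ∈ cut x → q ∈ cut y
  x ≈ᵢ y = (x ≤ᵢ y) × (y ≤ᵢ x)

  0ᵢ : 𝕀 ℓ
  0ᵢ = record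
    { cut      = λ q → Lift ℓ (q ℚ.< 0ℚ)
    ; negative = lift
    ; bounded  = λ q<0 → <-trans (lower q<0) 0<1
    ; downward = λ p<q q<0 → lift (<-trans p<q (lower q<0))
    ; open-cut = λ q<0 → let r , q<r , r<0 = <-dense (lower q<0) in r , q<r , lift r<0
    }

  -- min{x + y, 1}; the summands a, b may be negative.
  _⊕ᵢ_ : 𝕀 ℓ → 𝕀 ℓ → 𝕀 ℓ
  x ⊕ᵢ y = record
    { cut      = λ q → q ℚ.< 1ℚ ×
                       ∃[ a ] ∃[ b ] (a ∈ cut x × b ∈ cut y × q ℚ.≤ a ℚ.+ b)
    ; negative = λ {q} q<0 →
        <-trans q<0 0<1 , ½ ℚ.* q , ½ ℚ.* q ,
        negative x (half-negative q<0) , negative y (half-negative q<0) ,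
        ℚₚ.≤-reflexive (sym (halves q))
    ; bounded  = proj₁
    ; downward = λ (p<q) (q<1 , a , b , a∈x , b∈y , q≤a+b) →
        <-trans p<q q<1 , a , b , a∈x , b∈y , <⇒≤ (<-≤-trans p<q q≤a+b)
    ; open-cut = λ {q} (q<1 , a , b , a∈x , b∈y , q≤a+b) →
        let a′ , a<a′ , a′∈x = open-cut x a∈x
            q<a′+b           = ≤-<-trans q≤a+b (ℚₚ.+-monoˡ-< b a<a′)
            r , q<r , r<m    = <-dense (below-⊓ q<1 q<a′+b)
        in r , q<r , <-≤-trans r<m (ℚₚ.p⊓q≤p 1ℚ (a′ ℚ.+ b)) ,
           a′ , b , a′∈x , b∈y , <⇒≤ (<-≤-trans r<m (ℚₚ.p⊓q≤q 1ℚ (a′ ℚ.+ b)))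
    }
    where
    below-⊓ : ∀ {q u v} → q ℚ.< u → q ℚ.< v → q ℚ.< u ℚ.⊓ v
    below-⊓ {q} {u} {v} q<u q<v with ℚₚ.⊓-sel u v
    ... | _⊎_.inj₁ eq = subst (q ℚ.<_) (sym eq) q<u
    ... | _⊎_.inj₂ eq = subst (q ℚ.<_) (sym eq) q<v

  -- 1 - x: note that 1 - r ∉ cut x says x ≤ 1 - r.
  ∼ᵢ_ : 𝕀 ℓ → 𝕀 ℓ
  ∼ᵢ x = record
    { cut      = λ q → ∃[ r ] (q ℚ.< r × 1ℚ ℚ.- r ∉ cut x)
    ; negative = λ q<0 → 0ℚ , q<0 , λ 1∈x → <-irrefl refl (bounded x 1∈x)
    ; bounded  = λ (r , q<r , r∉) →
        <-≤-trans q<r (1-r≮0⇒r≤1 (λ 1-r<0 → r∉ (negative x 1-r<0)))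
    ; downward = λ p<q (r , q<r , r∉) → r , <-trans p<q q<r , r∉
    ; open-cut = λ (r , q<r , r∉) →
        let m , q<m , m<r = <-dense q<r in m , q<m , r , m<r , r∉
    }

  -- Infimum of a family; the infimum of the empty family is 1.
  ⋀ : ∀ {I : Set ℓ} → (I → 𝕀 ℓ) → 𝕀 ℓ
  ⋀ x = record
    { cut      = λ q → ∃[ r ] (q ℚ.< r × r ℚ.≤ 1ℚ × ∀ i → r ∈ cut (x i))
    ; negative = λ q<0 →
        let r , q<r , r<0 = <-dense q<0
        in r , q<r , <⇒≤ (<-trans r<0 0<1) , λ i → negative (x i) r<0
    ; bounded  = λ (r , q<r , r≤1 , _) → <-≤-trans q<r r≤1
    ; downward = λ p<q (r , q<r , rest) → r , <-trans p<q q<r , rest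
    ; open-cut = λ (r , q<r , rest) →
        let m , q<m , m<r = <-dense q<r in m , q<m , r , m<r , rest
    }

  ⋀-lowerBound : ∀ {I : Set ℓ} (x : I → 𝕀 ℓ) i → ⋀ x ≤ᵢ x i
  ⋀-lowerBound x i (r , q<r , _ , r∈) = downward (x i) q<r (r∈ i)

  ⋀-greatest : ∀ {I : Set ℓ} (x : I → 𝕀 ℓ) y → (∀ i → y ≤ᵢ x i) → y ≤ᵢ ⋀ x
  ⋀-greatest x y y≤x q∈y =
    let r , q<r , r∈y = open-cut y q∈y
    in r , q<r , <⇒≤ (bounded y r∈y) , λ i → y≤x i r∈y

standardMV : ∀ ℓ → RawMV (lsuc ℓ) ℓ
standardMV ℓ = record
  { Carrier = 𝕀 ℓ
  ; _≈_     = _≈ᵢ_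
  ; _⊕_     = _⊕ᵢ_
  ; ∼_      = ∼ᵢ_
  ; 𝟎       = 0ᵢ
  }

record UnitRational : Set where
  constructor unit
  field
    value : ℚ
    0≤    : 0ℚ ℚ.≤ value
    ≤1    : value ℚ.≤ 1ℚ

open UnitRational using (value)

record PavelkaAlgebra c ℓ : Set (lsuc (c ⊔ ℓ)) where
  field
    mvReduct : MVAlgebra c ℓ
  open MVAlgebra mvReduct public
  field
    const   : UnitRational → Carrier
    const-𝟎 : ∀ r → value r ≡ 0ℚ → const r ≈ 𝟎
    const-⊕ : ∀ r s t → (value r ℚ.+ value s) ℚ.⊓ 1ℚ ≡ value t → const r ⊕ const s ≈ const t
    const-∼ : ∀ r s → 1ℚ ℚ.- value r ≡ value s → ∼ const r ≈ const s

record TensePavelkaAlgebra c ℓ : Set (lsuc (c ⊔ ℓ)) where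
  field
    pavelka : PavelkaAlgebra c ℓ
  open PavelkaAlgebra pavelka public
  field
    G H    : Carrier → Carrier
    G-cong : Congruent _≈_ _≈_ G
    H-cong : Congruent _≈_ _≈_ H
    PT1-G  : ∀ x y → G (x ∧ y) ≈ G x ∧ G y
    PT1-H  : ∀ x y → H (x ∧ y) ≈ H x ∧ H y
    PT2-G  : ∀ r x → const r ⇒ G x ≈ G (const r ⇒ x)
    PT2-H  : ∀ r x → const r ⇒ H x ≈ H (const r ⇒ x)
    PT3-H  : ∀ x → ∼ H (∼ G x) ≤ x
    PT3-G  : ∀ x → ∼ G (∼ H x) ≤ x

record IsTenseMV {c ℓ} (A : MVAlgebra c ℓ) (G H : MVAlgebra.Carrier A → MVAlgebra.Carrier A) : Set (c ⊔ ℓ) where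
  open MVAlgebra A
  field
    T1-G : G 𝟏 ≈ 𝟏
    T1-H : H 𝟏 ≈ 𝟏
    T2-G : ∀ x y → G x · G y ≤ G (x · y)
    T2-H : ∀ x y → H x · H y ≤ H (x · y)
    T3-G : ∀ x y → G x ⊕ G y ≤ G (x ⊕ y)
    T3-H : ∀ x y → H x ⊕ H y ≤ H (x ⊕ y)
    T4-G : ∀ x → G x · G x ≈ G (x · x)
    T4-H : ∀ x → H x · H x ≈ H (x · x)
    T5-G : ∀ x → G x ⊕ G x ≈ G (x ⊕ x)
    T5-H : ∀ x → H x ⊕ H x ≈ H (x ⊕ x)
    T6-G : ∀ x → ∼ G (∼ H x) ≤ x
    T6-H : ∀ x → ∼ H (∼ G x) ≤ x

record TimeFrame x ℓ : Set (lsuc (x ⊔ ℓ)) where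
  field
    Point : Set x
    R     : Point → Point → 𝕀 ℓ

IsBoolean : ∀ {x ℓ} → TimeFrame x ℓ → Set (x ⊔ ℓ)
IsBoolean {ℓ = ℓ} T = ∀ s t → (R s t ≈ 𝟎) ⊎ (R s t ≈ 𝟏)
  where
  open TimeFrame T
  open RawMV (standardMV ℓ)

module _ {c ℓ} (T : TensePavelkaAlgebra c ℓ) where
  open TensePavelkaAlgebra T

  -- For each F the embedding exists and is unique up to ≈, so quantifying
  -- over SpectralEmbedding picks out the canonical identification of x/F
  -- with a real number.
  SpectralEmbedding : Set (lsuc (c ⊔ ℓ))
  SpectralEmbedding = (F : SpecM mvReduct) →
    MVEmbedding (_/_ mvReduct (SpecM.filter F)) (standardMV (c ⊔ ℓ))

  module _ (ν : SpectralEmbedding) where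

    valueAt : Carrier → SpecM mvReduct → 𝕀 (c ⊔ ℓ)
    valueAt x F = MVEmbedding.⟦_⟧ (ν F) x

    naturalTimeFrame : TimeFrame (lsuc (c ⊔ ℓ)) (c ⊔ ℓ)
    naturalTimeFrame = record
      { Point = SpecM mvReduct
      ; R     = λ F F′ → ⋀ {I = Lift (c ⊔ ℓ) Carrier} λ (lift a) →
                  RawMV._⇒_ (standardMV (c ⊔ ℓ)) (valueAt (G a) F′) (valueAt a F)
      }

{-# OPTIONS --safe #-}
module Submission where

open import Defs
open import Axiom.ExcludedMiddle using (ExcludedMiddle)
open import Data.Product using (_×_)
open import Function.Bundles using (_⇔_)

open import Level using (_⊔_; Lift; lift; lower) renaming (suc to lsuc)
open import Algebra.Bundles using (CommutativeMonoid)
import Algebra.Properties.CommutativeSemigroup as CommutativeSemigroupProperties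
open import Data.Empty using (⊥-elim)
import Data.Integer as ℤ
import Data.Integer.Properties as ℤₚ
import Data.Integer.Solver
open import Data.Nat.Base as ℕ using (ℕ; zero; suc)
import Data.Nat.Properties as ℕₚ
open import Data.Product using (Σ; _,_; proj₁; proj₂; ∃-syntax; swap)
open import Data.Rational using (ℚ; 0ℚ; 1ℚ; ½; _+_; _-_; _*_; _⊓_)
import Data.Rational as ℚ
import Data.Rational.Properties as ℚₚ
import Data.Rational.Solver
import Data.Rational.Unnormalised as ℚᵘ
import Data.Rational.Unnormalised.Properties as ℚᵘₚ
open import Data.Sum using (_⊎_; inj₁; inj₂; [_,_]′)
open import Function.Base using (_∘_; id)
open import Function.Bundles using (mk⇔)
open import Relation.Binary.Bundles using (Poset)
open import Relation.Binary.Core using (Rel)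
open import Relation.Binary.PropositionalEquality using (_≡_; refl; subst; cong)
import Relation.Binary.PropositionalEquality as ≡
import Relation.Binary.Reasoning.Setoid as SetoidReasoning
open import Relation.Nullary using (¬_; yes; no)
open import Relation.Nullary.Decidable using (True; toWitness; fromWitness; decidable-stable)
open import Relation.Unary using (Pred; _∈_; _∉_; _⊆_)

open Data.Rational.Solver.+-*-Solver using (solve; _:=_; _:+_; _:-_; _:*_; con)
open UnitRational using (value; 0≤; ≤1)

-- For points F, F′ the relation R(F, F′) is determined by {a | G a ∈ F′}: since G commutes
-- with the maps x ↦ r ⇒ x, R(F, F′) = 1 holds iff G a ∈ F′ implies a ∈ F for all a.  If G is
-- submultiplicative and this fails at a, then the iterated squares of a drive R(F, F′) to 0.
-- Conversely, if R is boolean, a Zorn argument gives for every y with G y ∉ F′ a point F with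
-- R(F, F′) = 1 and y ∉ F.  Hence G is the box operator of a crisp relation, all its laws can be
-- checked pointwise on rational bounds, and semisimplicity carries them back to the algebra.
-- The relation of H is the converse one, which gives the symmetry between G and H.

-- MV-algebras and their filters

-- Two obstacles shape the proof. A boolean frame says only that some infima of reals are 0, without
-- an element at which 0 is attained. `Crisp` asks for such an element, `Semicrisp` merely excludes
-- positive lower bounds. Submultiplicativity yields the former, boolean values directly yield the
-- latter, and the representation of `G` starts from the latter; its Zorn step accordingly secures a
-- positive value of R, which then has to be 1. The other obstacle is that the frame takes real
-- values while the algebra contains only rational constants. Comparisons in a quotient are
-- therefore expressed by `const r ⊑ x`: maximality makes the quotient a chain, bisection gives
-- rational bounds of any precision, and limits become downward induction on a tolerance
-- (`halving`).

module MVProperties {c ℓ} (A : MVAlgebra c ℓ) where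
  open MVAlgebra A

  ⊕-commutativeMonoid : CommutativeMonoid c ℓ
  ⊕-commutativeMonoid = record { isCommutativeMonoid = ⊕-isCommutativeMonoid }

  open CommutativeMonoid ⊕-commutativeMonoid public
    using (setoid)
    renaming ( refl to ≈-refl; sym to ≈-sym; trans to ≈-trans; ∙-cong to ⊕-cong
             ; ∙-congˡ to ⊕-congˡ; ∙-congʳ to ⊕-congʳ; assoc to ⊕-assoc; comm to ⊕-comm
             ; identityˡ to ⊕-identityˡ; identityʳ to ⊕-identityʳ)
  open CommutativeSemigroupProperties
    (CommutativeMonoid.commutativeSemigroup ⊕-commutativeMonoid) public
    using () renaming (x∙yz≈y∙xz to ⊕-swap)
  open SetoidReasoning setoid

  ∼𝟏≈𝟎 : ∼ 𝟏 ≈ 𝟎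
  ∼𝟏≈𝟎 = ∼-involutive 𝟎

  ⊕-zeroˡ : ∀ x → 𝟏 ⊕ x ≈ 𝟏
  ⊕-zeroˡ x = ≈-trans (⊕-comm 𝟏 x) (⊕-zeroʳ x)

  ∼𝟏⊕x≈x : ∀ x → ∼ 𝟏 ⊕ x ≈ x
  ∼𝟏⊕x≈x x = ≈-trans (⊕-congʳ ∼𝟏≈𝟎) (⊕-identityˡ x)

  ≤-refl : ∀ {x} → x ≤ x
  ≤-refl {x} = begin
    ∼ x ⊕ x            ≈⟨ ⊕-congʳ (∼-cong (∼𝟏⊕x≈x x)) ⟨
    ∼ (∼ 𝟏 ⊕ x) ⊕ x    ≈⟨ ∨-comm 𝟏 x ⟩
    ∼ (∼ x ⊕ 𝟏) ⊕ 𝟏    ≈⟨ ⊕-zeroʳ _ ⟩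
    𝟏                  ∎

  ≤-reflexive : ∀ {x y} → x ≈ y → x ≤ y
  ≤-reflexive x≈y = ≈-trans (⊕-congˡ (≈-sym x≈y)) ≤-refl

  x≤y⇒x∨y≈y : ∀ {x y} → x ≤ y → x ∨ y ≈ y
  x≤y⇒x∨y≈y {x} {y} x≤y = ≈-trans (⊕-congʳ (∼-cong x≤y)) (∼𝟏⊕x≈x y)

  x≤y⇒y≈w⊕x : ∀ {x y} → x ≤ y → y ≈ ∼ (∼ y ⊕ x) ⊕ x
  x≤y⇒y≈w⊕x {x} {y} x≤y = ≈-trans (≈-sym (x≤y⇒x∨y≈y x≤y)) (∨-comm x y)

  x≤y⇒x≤w⊕y : ∀ {w x y} → x ≤ y → x ≤ w ⊕ y
  x≤y⇒x≤w⊕y {w} {x} {y} x≤y = begin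
    ∼ x ⊕ (w ⊕ y)   ≈⟨ ⊕-swap (∼ x) w y ⟩
    w ⊕ (∼ x ⊕ y)   ≈⟨ ⊕-congˡ x≤y ⟩
    w ⊕ 𝟏           ≈⟨ ⊕-zeroʳ w ⟩
    𝟏               ∎

  x≤w⊕x : ∀ {w x} → x ≤ w ⊕ x
  x≤w⊕x = x≤y⇒x≤w⊕y ≤-refl

  ≤-respʳ-≈ : ∀ {x y z} → y ≈ z → x ≤ y → x ≤ z
  ≤-respʳ-≈ y≈z x≤y = ≈-trans (⊕-congˡ (≈-sym y≈z)) x≤y

  ≤-respˡ-≈ : ∀ {x y z} → x ≈ y → x ≤ z → y ≤ z
  ≤-respˡ-≈ x≈y x≤z = ≈-trans (⊕-congʳ (∼-cong (≈-sym x≈y))) x≤z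

  ≤-trans : ∀ {x y z} → x ≤ y → y ≤ z → x ≤ z
  ≤-trans x≤y y≤z = ≤-respʳ-≈ (≈-sym (x≤y⇒y≈w⊕x y≤z)) (x≤y⇒x≤w⊕y x≤y)

  ≤-antisym : ∀ {x y} → x ≤ y → y ≤ x → x ≈ y
  ≤-antisym {x} {y} x≤y y≤x = begin
    x       ≈⟨ x≤y⇒x∨y≈y y≤x ⟨
    y ∨ x   ≈⟨ ∨-comm y x ⟩
    x ∨ y   ≈⟨ x≤y⇒x∨y≈y x≤y ⟩
    y       ∎

  x≤𝟏 : ∀ {x} → x ≤ 𝟏
  x≤𝟏 = ⊕-zeroʳ _

  𝟎≤x : ∀ {x} → 𝟎 ≤ x
  𝟎≤x = ⊕-zeroˡ _

  𝟏≤x⇒x≈𝟏 : ∀ {x} → 𝟏 ≤ x → x ≈ 𝟏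
  𝟏≤x⇒x≈𝟏 𝟏≤x = ≤-antisym x≤𝟏 𝟏≤x

  ∼-anti : ∀ {x y} → x ≤ y → ∼ y ≤ ∼ x
  ∼-anti {x} {y} x≤y = begin
    ∼ ∼ y ⊕ ∼ x   ≈⟨ ⊕-congʳ (∼-involutive y) ⟩
    y ⊕ ∼ x       ≈⟨ ⊕-comm y (∼ x) ⟩
    ∼ x ⊕ y       ≈⟨ x≤y ⟩
    𝟏             ∎

  ⊕-monoˡ : ∀ {x y z} → x ≤ y → x ⊕ z ≤ y ⊕ z
  ⊕-monoˡ {x} {y} {z} x≤y =
    ≤-respʳ-≈ (≈-trans (≈-sym (⊕-assoc _ x z)) (⊕-congʳ (≈-sym (x≤y⇒y≈w⊕x x≤y)))) x≤w⊕x

  ⊕-mono : ∀ {x x′ y y′} → x ≤ x′ → y ≤ y′ → x ⊕ y ≤ x′ ⊕ y′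
  ⊕-mono x≤x′ y≤y′ = ≤-trans (⊕-monoˡ x≤x′)
    (≤-respʳ-≈ (⊕-comm _ _) (≤-respˡ-≈ (⊕-comm _ _) (⊕-monoˡ y≤y′)))

  ·-cong : ∀ {x x′ y y′} → x ≈ x′ → y ≈ y′ → x · y ≈ x′ · y′
  ·-cong x≈x′ y≈y′ = ∼-cong (⊕-cong (∼-cong x≈x′) (∼-cong y≈y′))

  ·-mono : ∀ {x x′ y y′} → x ≤ x′ → y ≤ y′ → x · y ≤ x′ · y′
  ·-mono x≤x′ y≤y′ = ∼-anti (⊕-mono (∼-anti x≤x′) (∼-anti y≤y′))

  ·-comm : ∀ x y → x · y ≈ y · x
  ·-comm x y = ∼-cong (⊕-comm _ _)

  ·-assoc : ∀ x y z → (x · y) · z ≈ x · (y · z)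
  ·-assoc x y z = ∼-cong (begin
    ∼ ∼ (∼ x ⊕ ∼ y) ⊕ ∼ z   ≈⟨ ⊕-congʳ (∼-involutive _) ⟩
    (∼ x ⊕ ∼ y) ⊕ ∼ z       ≈⟨ ⊕-assoc _ _ _ ⟩
    ∼ x ⊕ (∼ y ⊕ ∼ z)       ≈⟨ ⊕-congˡ (∼-involutive _) ⟨
    ∼ x ⊕ ∼ ∼ (∼ y ⊕ ∼ z)   ∎)

  x·y⇒z≈x⇒y⇒z : ∀ x y z → (x · y) ⇒ z ≈ x ⇒ (y ⇒ z)
  x·y⇒z≈x⇒y⇒z x y z = ≈-trans (⊕-congʳ (∼-involutive _)) (⊕-assoc _ _ _)

  curry≤ : ∀ {x y z} → x · y ≤ z → x ≤ y ⇒ z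
  curry≤ {x} {y} {z} xy≤z = ≈-trans (≈-sym (x·y⇒z≈x⇒y⇒z x y z)) xy≤z

  uncurry≤ : ∀ {x y z} → x ≤ y ⇒ z → x · y ≤ z
  uncurry≤ {x} {y} {z} x≤y⇒z = ≈-trans (x·y⇒z≈x⇒y⇒z x y z) x≤y⇒z

  ·-swap : ∀ x y z → x · (y · z) ≈ y · (x · z)
  ·-swap x y z = begin
    x · (y · z)   ≈⟨ ·-assoc x y z ⟨
    (x · y) · z   ≈⟨ ·-cong (·-comm x y) ≈-refl ⟩
    (y · x) · z   ≈⟨ ·-assoc y x z ⟩
    y · (x · z)   ∎

  ·-identityˡ : ∀ x → 𝟏 · x ≈ x
  ·-identityˡ x = ≈-trans (∼-cong (∼𝟏⊕x≈x _)) (∼-involutive x)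

  x·y≤x : ∀ {x y} → x · y ≤ x
  x·y≤x {x} {y} = ≤-respʳ-≈ (≈-trans (·-comm x 𝟏) (·-identityˡ x)) (·-mono ≤-refl x≤𝟏)

  x·y≤y : ∀ {x y} → x · y ≤ y
  x·y≤y = ≤-respˡ-≈ (·-comm _ _) x·y≤x

  x·∼x≤𝟎 : ∀ {x} → x · ∼ x ≤ 𝟎
  x·∼x≤𝟎 {x} = uncurry≤ (≤-reflexive (≈-sym (≈-trans (⊕-congʳ (∼-involutive x)) (⊕-identityʳ x))))

  modus-ponens : ∀ {x y} → (x ⇒ y) · x ≤ y
  modus-ponens = uncurry≤ ≤-refl

  ⇒-mono : ∀ {x x′ y y′} → x′ ≤ x → y ≤ y′ → x ⇒ y ≤ x′ ⇒ y′
  ⇒-mono x′≤x y≤y′ = ⊕-mono (∼-anti x′≤x) y≤y′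

  ⇒-contrapositive : ∀ x y → ∼ y ⇒ ∼ x ≈ x ⇒ y
  ⇒-contrapositive x y = ≈-trans (⊕-congʳ (∼-involutive y)) (⊕-comm y (∼ x))

  𝟏⇒x≈x : ∀ x → 𝟏 ⇒ x ≈ x
  𝟏⇒x≈x = ∼𝟏⊕x≈x

  ⇒𝟎≈∼ : ∀ x → x ⇒ 𝟎 ≈ ∼ x
  ⇒𝟎≈∼ x = ⊕-identityʳ (∼ x)

  y≤x⇒y : ∀ {x y} → y ≤ x ⇒ y
  y≤x⇒y = x≤w⊕x

  ∼x≤x⇒y : ∀ {x y} → ∼ x ≤ x ⇒ y
  ∼x≤x⇒y = ≤-respʳ-≈ (⊕-comm _ _) x≤w⊕x

  y≤x∨y : ∀ {x y} → y ≤ x ∨ y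
  y≤x∨y = x≤w⊕x

  x≤x∨y : ∀ {x y} → x ≤ x ∨ y
  x≤x∨y {x} {y} = ≤-respʳ-≈ (∨-comm y x) x≤w⊕x

  ∨-lub : ∀ {x y z} → x ≤ z → y ≤ z → x ∨ y ≤ z
  ∨-lub {x} {y} {z} x≤z y≤z =
    ≤-respʳ-≈ (≈-trans (∨-comm z y) (x≤y⇒x∨y≈y y≤z))
      (⊕-monoˡ (∼-anti (⊕-monoˡ (∼-anti x≤z))))

  x∧y≤x : ∀ {x y} → x ∧ y ≤ x
  x∧y≤x = ≤-respʳ-≈ (∼-involutive _) (∼-anti x≤x∨y)

  x∧y≤y : ∀ {x y} → x ∧ y ≤ y
  x∧y≤y = ≤-respʳ-≈ (∼-involutive _) (∼-anti y≤x∨y)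

  ∧-glb : ∀ {x y z} → z ≤ x → z ≤ y → z ≤ x ∧ y
  ∧-glb z≤x z≤y = ≤-respˡ-≈ (∼-involutive _) (∼-anti (∨-lub (∼-anti z≤x) (∼-anti z≤y)))

  x·[x⇒y]≤y : ∀ {x y} → x · (x ⇒ y) ≤ y
  x·[x⇒y]≤y = ≤-respˡ-≈ (·-comm _ _) modus-ponens

  x∧y≈x·[x⇒y] : ∀ x y → x ∧ y ≈ x · (x ⇒ y)
  x∧y≈x·[x⇒y] x y = ∼-cong (begin
    ∼ (∼ ∼ x ⊕ ∼ y) ⊕ ∼ y   ≈⟨ ∨-comm (∼ x) (∼ y) ⟩
    ∼ (∼ ∼ y ⊕ ∼ x) ⊕ ∼ x   ≈⟨ ⊕-comm _ _ ⟩
    ∼ x ⊕ ∼ (∼ ∼ y ⊕ ∼ x)   ≈⟨ ⊕-congˡ (∼-cong (⇒-contrapositive x y)) ⟩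
    ∼ x ⊕ ∼ (x ⇒ y)         ∎)

  ∧-comm : ∀ x y → x ∧ y ≈ y ∧ x
  ∧-comm x y = ∼-cong (∨-comm (∼ x) (∼ y))

  ∼[x⇒y]≈x·∼y : ∀ x y → ∼ (x ⇒ y) ≈ x · ∼ y
  ∼[x⇒y]≈x·∼y x y = ∼-cong (⊕-congˡ (≈-sym (∼-involutive y)))

  -- Chang's identity: with q = y · ∼x and w = ∼x ⊕ q, the meet of x · ∼y and q is
  -- rewritten by divisibility until it lies below x · ∼x.
  prelinear : ∀ x y → (x ⇒ y) ∨ (y ⇒ x) ≈ 𝟏
  prelinear x y = 𝟏≤x⇒x≈𝟏
    (≤-respʳ-≈ (∼-involutive _) (∼-anti meet≤𝟎))
    where
    q w : Carrier
    q = y · ∼ x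
    w = ∼ x ⊕ q

    expand : ∼ ((x ⇒ y) ∨ (y ⇒ x)) ≈ (x · ∼ y) · (y ⊕ w)
    expand = begin
      ∼ ((x ⇒ y) ∨ (y ⇒ x))
        ≈⟨ ∼-cong (⊕-cong (∼-cong (⊕-cong (∼-cong (∼-involutive _)) (∼-involutive _))) (∼-involutive _)) ⟨
      ∼ (x ⇒ y) ∧ ∼ (y ⇒ x)           ≈⟨ x∧y≈x·[x⇒y] _ _ ⟩
      ∼ (x ⇒ y) · (∼ (x ⇒ y) ⇒ ∼ (y ⇒ x))
        ≈⟨ ·-cong (∼[x⇒y]≈x·∼y x y) (⊕-cong (≈-trans (∼-involutive _) (⊕-comm _ _)) (∼[x⇒y]≈x·∼y y x)) ⟩
      (x · ∼ y) · ((y ⊕ ∼ x) ⊕ q)     ≈⟨ ·-cong ≈-refl (⊕-assoc y (∼ x) q) ⟩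
      (x · ∼ y) · (y ⊕ w)             ∎

    divide : (x · ∼ y) · (y ⊕ w) ≈ (x ∧ q) · (w ⇒ ∼ y)
    divide = begin
      (x · ∼ y) · (y ⊕ w)       ≈⟨ ·-assoc x (∼ y) _ ⟩
      x · (∼ y · (y ⊕ w))       ≈⟨ ·-cong ≈-refl (·-cong ≈-refl (⊕-congʳ (∼-involutive y))) ⟨
      x · (∼ y · (∼ y ⇒ w))     ≈⟨ ·-cong ≈-refl (x∧y≈x·[x⇒y] (∼ y) w) ⟨
      x · (∼ y ∧ w)             ≈⟨ ·-cong ≈-refl (∧-comm (∼ y) w) ⟩
      x · (w ∧ ∼ y)             ≈⟨ ·-cong ≈-refl (x∧y≈x·[x⇒y] w (∼ y)) ⟩
      x · (w · (w ⇒ ∼ y))       ≈⟨ ·-assoc x w _ ⟨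
      (x · w) · (w ⇒ ∼ y)       ≈⟨ ·-cong (x∧y≈x·[x⇒y] x q) ≈-refl ⟨
      (x ∧ q) · (w ⇒ ∼ y)       ∎

    collapse : q · (w ⇒ ∼ y) ≤ 𝟎
    collapse = ≤-respˡ-≈ (≈-sym regroup)
      (≤-trans (·-mono (≤-refl {∼ x}) x·[x⇒y]≤y)
        (≤-trans (·-mono ≤-refl (∼-anti (≤-respʳ-≈ (⊕-comm _ _) x≤w⊕x)))
          x·∼x≤𝟎))
      where
      regroup : q · (w ⇒ ∼ y) ≈ ∼ x · (y · (y ⇒ ∼ w))
      regroup = begin
        (y · ∼ x) · (w ⇒ ∼ y)     ≈⟨ ·-cong (·-comm y (∼ x)) (⊕-comm _ _) ⟩
        (∼ x · y) · (y ⇒ ∼ w)     ≈⟨ ·-assoc (∼ x) y _ ⟩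
        ∼ x · (y · (y ⇒ ∼ w))     ∎

    meet≤𝟎 : ∼ ((x ⇒ y) ∨ (y ⇒ x)) ≤ 𝟎
    meet≤𝟎 = ≤-respˡ-≈ (≈-sym (≈-trans expand divide))
      (≤-trans (·-mono x∧y≤y ≤-refl) collapse)

  -- This is the power of `x` with exponent 2^n. Powers decrease, so these exponents are cofinal,
  -- and each squaring is one use of a binary law or one doubling of a rational gap.
  sq^ : ℕ → Carrier → Carrier
  sq^ zero    x = x
  sq^ (suc n) x = sq^ n x · sq^ n x

  sq^-mono : ∀ n {x y} → x ≤ y → sq^ n x ≤ sq^ n y
  sq^-mono zero    x≤y = x≤y
  sq^-mono (suc n) x≤y = ·-mono (sq^-mono n x≤y) (sq^-mono n x≤y)

  sq^-· : ∀ n x y → sq^ n (x · y) ≈ sq^ n x · sq^ n y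
  sq^-· zero    x y = ≈-refl
  sq^-· (suc n) x y = begin
    sq^ n (x · y) · sq^ n (x · y)   ≈⟨ ·-cong (sq^-· n x y) (sq^-· n x y) ⟩
    (p · q) · (p · q)               ≈⟨ ·-assoc p q (p · q) ⟩
    p · (q · (p · q))               ≈⟨ ·-cong ≈-refl (·-swap q p q) ⟩
    p · (p · (q · q))               ≈⟨ ·-assoc p p (q · q) ⟨
    (p · p) · (q · q)               ∎
    where
    p = sq^ n x
    q = sq^ n y

  sq^-decreasing : ∀ n k {x} → sq^ (n ℕ.+ k) x ≤ sq^ k x
  sq^-decreasing zero    k = ≤-refl
  sq^-decreasing (suc n) k = ≤-trans x·y≤x (sq^-decreasing n k)

  -- Expand `(x ∨ y) · (x ∨ y)`: every term except `x · x` has a factor `y` and so lies below `y`.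
  ∨-≈𝟏-square : ∀ {x y} → x ∨ y ≈ 𝟏 → (x · x) ∨ y ≈ 𝟏
  ∨-≈𝟏-square {x} {y} x∨y≈𝟏 = 𝟏≤x⇒x≈𝟏
    (≤-respˡ-≈ (≈-trans (·-cong x∨y≈𝟏 x∨y≈𝟏) (·-identityˡ 𝟏))
      (uncurry≤ (∨-lub
        (curry≤ (≤-respˡ-≈ (·-comm _ _)
          (uncurry≤ (∨-lub (curry≤ x≤x∨y) (curry≤ (≤-trans x·y≤x y≤x∨y))))))
        (curry≤ (≤-trans x·y≤x y≤x∨y)))))

  ∨-≈𝟏-sq^ : ∀ n {x y} → x ∨ y ≈ 𝟏 → sq^ n x ∨ y ≈ 𝟏
  ∨-≈𝟏-sq^ zero    x∨y≈𝟏 = x∨y≈𝟏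
  ∨-≈𝟏-sq^ (suc n) x∨y≈𝟏 = ∨-≈𝟏-square (∨-≈𝟏-sq^ n x∨y≈𝟏)

module FilterProperties {c ℓ} (A : MVAlgebra c ℓ) {F : Pred (MVAlgebra.Carrier A) (c ⊔ ℓ)}
                        (isFilter : IsFilter A F) where
  open MVAlgebra A
  open MVProperties A
  open IsFilter isFilter public

  infix 4 _⊑_

  _⊑_ : Rel Carrier (c ⊔ ℓ)
  x ⊑ y = x ⇒ y ∈ F

  ≈𝟏⇒∈ : ∀ {x} → x ≈ 𝟏 → x ∈ F
  ≈𝟏⇒∈ x≈𝟏 = upward (≤-reflexive (≈-sym x≈𝟏)) 𝟏∈

  ∈-resp-≈ : ∀ {x y} → x ≈ y → x ∈ F → y ∈ F
  ∈-resp-≈ x≈y = upward (≤-reflexive x≈y)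

  ≤⇒⊑ : ∀ {x y} → x ≤ y → x ⊑ y
  ≤⇒⊑ = ≈𝟏⇒∈

  ∈-mp : ∀ {x y} → x ⊑ y → x ∈ F → y ∈ F
  ∈-mp x⊑y x∈F = upward modus-ponens (·-closed x⊑y x∈F)

  ∈⇒⊑ : ∀ {x y} → y ∈ F → x ⊑ y
  ∈⇒⊑ = upward y≤x⇒y

  ⊑-trans : ∀ {x y z} → x ⊑ y → y ⊑ z → x ⊑ z
  ⊑-trans {x} {y} {z} x⊑y y⊑z = upward (curry≤ step) (·-closed y⊑z x⊑y)
    where
    step : ((y ⇒ z) · (x ⇒ y)) · x ≤ z
    step = ≤-respˡ-≈ (≈-sym (·-assoc _ _ _)) (≤-trans (·-mono ≤-refl modus-ponens) modus-ponens)

  ⊑-respˡ-≈ : ∀ {x y z} → x ≈ y → x ⊑ z → y ⊑ z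
  ⊑-respˡ-≈ x≈y x⊑z = ⊑-trans (≤⇒⊑ (≤-reflexive (≈-sym x≈y))) x⊑z

  ⊑-respʳ-≈ : ∀ {x y z} → y ≈ z → x ⊑ y → x ⊑ z
  ⊑-respʳ-≈ y≈z x⊑y = ⊑-trans x⊑y (≤⇒⊑ (≤-reflexive y≈z))

  ∼-anti-⊑ : ∀ {x y} → x ⊑ y → ∼ y ⊑ ∼ x
  ∼-anti-⊑ = ∈-resp-≈ (≈-sym (⇒-contrapositive _ _))

  ⊕-monoˡ-⊑ : ∀ {x y z} → x ⊑ y → x ⊕ z ⊑ y ⊕ z
  ⊕-monoˡ-⊑ {x} {y} {z} = upward (≤-respʳ-≈ (begin
    y ⊕ ∼ (x ⊕ z) ⊕ z     ≈⟨ ⊕-assoc _ _ _ ⟩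
    y ⊕ (∼ (x ⊕ z) ⊕ z)   ≈⟨ ⊕-swap _ _ _ ⟩
    ∼ (x ⊕ z) ⊕ (y ⊕ z)   ∎)
    (≤-respˡ-≈ (⊕-comm y (∼ x))
      (≤-respʳ-≈ (≈-sym (⊕-assoc _ _ _)) (⊕-mono ≤-refl ∼x≤∼[x⊕z]⊕z))))
    where
    open SetoidReasoning setoid
    ∼x≤∼[x⊕z]⊕z : ∼ x ≤ ∼ (x ⊕ z) ⊕ z
    ∼x≤∼[x⊕z]⊕z = ≤-respʳ-≈ (⊕-congʳ (∼-cong (⊕-congʳ (∼-involutive x)))) x≤x∨y

  ⊕-monoʳ-⊑ : ∀ {x y z} → x ⊑ y → z ⊕ x ⊑ z ⊕ y
  ⊕-monoʳ-⊑ x⊑y = ⊑-respˡ-≈ (⊕-comm _ _) (⊑-respʳ-≈ (⊕-comm _ _) (⊕-monoˡ-⊑ x⊑y))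

  ⊕-mono-⊑ : ∀ {x x′ y y′} → x ⊑ x′ → y ⊑ y′ → x ⊕ y ⊑ x′ ⊕ y′
  ⊕-mono-⊑ x⊑x′ y⊑y′ = ⊑-trans (⊕-monoˡ-⊑ x⊑x′) (⊕-monoʳ-⊑ y⊑y′)

  ·-mono-⊑ : ∀ {x x′ y y′} → x ⊑ x′ → y ⊑ y′ → x · y ⊑ x′ · y′
  ·-mono-⊑ x⊑x′ y⊑y′ = ∼-anti-⊑ (⊕-mono-⊑ (∼-anti-⊑ x⊑x′) (∼-anti-⊑ y⊑y′))

  curry⊑ : ∀ {x y z} → x · y ⊑ z → x ⊑ y ⇒ z
  curry⊑ = ∈-resp-≈ (x·y⇒z≈x⇒y⇒z _ _ _)

  uncurry⊑ : ∀ {x y z} → x ⊑ y ⇒ z → x · y ⊑ z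
  uncurry⊑ = ∈-resp-≈ (≈-sym (x·y⇒z≈x⇒y⇒z _ _ _))

  sq^-closed : ∀ n {x} → x ∈ F → sq^ n x ∈ F
  sq^-closed zero    x∈F = x∈F
  sq^-closed (suc n) x∈F = ·-closed (sq^-closed n x∈F) (sq^-closed n x∈F)

  sq^-mono-⊑ : ∀ n {x y} → x ⊑ y → sq^ n x ⊑ sq^ n y
  sq^-mono-⊑ zero    x⊑y = x⊑y
  sq^-mono-⊑ (suc n) x⊑y = ·-mono-⊑ (sq^-mono-⊑ n x⊑y) (sq^-mono-⊑ n x⊑y)

  congruence : IsMVCongruence A (λ x y → (x ⊑ y) × (y ⊑ x))
  congruence = record
    { isEquivalence = record
      { refl  = ≤⇒⊑ ≤-refl , ≤⇒⊑ ≤-refl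
      ; sym   = swap
      ; trans = λ (x⊑y , y⊑x) (y⊑z , z⊑y) → ⊑-trans x⊑y y⊑z , ⊑-trans z⊑y y⊑x
      }
    ; ≈⇒θ          = λ x≈y → ≤⇒⊑ (≤-reflexive x≈y) , ≤⇒⊑ (≤-reflexive (≈-sym x≈y))
    ; ⊕-compatible = λ (p , p′) (q , q′) → ⊕-mono-⊑ p q , ⊕-mono-⊑ p′ q′
    ; ∼-compatible = λ (p , p′) → ∼-anti-⊑ p′ , ∼-anti-⊑ p
    }

module Generated {c ℓ} (A : MVAlgebra c ℓ) (D : Pred (MVAlgebra.Carrier A) (c ⊔ ℓ)) where
  open MVAlgebra A
  open MVProperties A

  -- For nonempty, downward directed `D` this is the generated filter: a product of several
  -- generators lies above a power of one common lower bound, so a single generator suffices.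
  Gen : Pred Carrier (c ⊔ ℓ)
  Gen z = ∃[ d ] (d ∈ D × ∃[ n ] sq^ n d ≤ z)

  D⊆Gen : D ⊆ Gen
  D⊆Gen {d} d∈D = d , d∈D , 0 , ≤-refl

  Gen-isFilter : (∃[ d ] d ∈ D) → (∀ {x y} → x ∈ D → y ∈ D → ∃[ z ] (z ∈ D × z ≤ x × z ≤ y)) →
                 IsFilter A Gen
  Gen-isFilter (d₀ , d₀∈D) directed = record
    { 𝟏∈       = d₀ , d₀∈D , 0 , x≤𝟏
    ; ·-closed = λ { (d , d∈D , m , p) (e , e∈D , n , q) →
        let f , f∈D , f≤d , f≤e = directed d∈D e∈D
        -- The outer squaring supplies the two factors; each still has exponent `n + m`, enough to
        -- fall below either given power.
        in f , f∈D , suc (n ℕ.+ m) ,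
           ·-mono (≤-trans (sq^-decreasing n m) (≤-trans (sq^-mono m f≤d) p))
                  (≤-trans (≤-respˡ-≈ (sq^-+-comm n m) (sq^-decreasing m n)) (≤-trans (sq^-mono n f≤e) q)) }
    ; upward   = λ x≤y (d , d∈D , n , p) → d , d∈D , n , ≤-trans p x≤y
    }
    where
    sq^-+-comm : ∀ n m {x} → sq^ (m ℕ.+ n) x ≈ sq^ (n ℕ.+ m) x
    sq^-+-comm n m {x} rewrite ℕₚ.+-comm m n = ≈-refl

-- Maximal filters

module Classical (em : ∀ {ℓ} → ExcludedMiddle ℓ) where

  dne : ∀ {a} {P : Set a} → ¬ ¬ P → P
  dne = decidable-stable em

  -- Excluded middle makes Set impredicative: every proposition has a copy in each universe.
  Resize : ∀ {a} b → Set a → Set b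
  Resize b P = Lift b (True (em {P = P}))

  resize : ∀ {a b} {P : Set a} → P → Resize b P
  resize p = lift (fromWitness p)

  unresize : ∀ {a b} {P : Set a} → Resize b P → P
  unresize r = toWitness (lower r)

  module _ {c ℓ} (A : MVAlgebra c ℓ) (zorn : ZornsLemma (lsuc (c ⊔ ℓ)) (c ⊔ ℓ) (c ⊔ ℓ) (lsuc (c ⊔ ℓ))) where
    open MVAlgebra A

    maximalFilterAbove : ∀ B → IsProperFilter A B → Σ (SpecM A) λ F → B ⊆ SpecM.filter F
    maximalFilterAbove B B-proper = record
      { filter         = Above.pred m
      ; isProperFilter = Above.isProper m
      ; maximal        = λ F F-proper m⊆F →
          proj₁ (m-maximal {record { pred = F ; isProper = F-proper ; above = m⊆F ∘ Above.above m }} m⊆F)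
      } , Above.above m
      where
      record Above : Set (lsuc (c ⊔ ℓ)) where
        field
          pred     : Pred Carrier (c ⊔ ℓ)
          isProper : IsProperFilter A pred
          above    : B ⊆ pred
        open IsProperFilter isProper public

      abovePoset : Poset (lsuc (c ⊔ ℓ)) (c ⊔ ℓ) (c ⊔ ℓ)
      abovePoset = record
        { Carrier = Above
        ; _≈_ = λ E F → (Above.pred E ⊆ Above.pred F) × (Above.pred F ⊆ Above.pred E)
        ; _≤_ = λ E F → Above.pred E ⊆ Above.pred F
        ; isPartialOrder = record
          { isPreorder = record
            { isEquivalence = record
              { refl  = id , id
              ; sym   = swap
              ; trans = λ (p , p′) (q , q′) → q ∘ p , p′ ∘ q′
              }
            ; reflexive = proj₁
            ; trans     = λ p q → q ∘ p
            }
          ; antisym = _,_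
          }
        }

      upperBound : (C : Pred Above (lsuc (c ⊔ ℓ))) →
        (∀ {E F} → E ∈ C → F ∈ C → (Above.pred E ⊆ Above.pred F) ⊎ (Above.pred F ⊆ Above.pred E)) →
        ∃[ U ] (∀ {E} → E ∈ C → Above.pred E ⊆ Above.pred U)
      upperBound C chain with em {P = ∃[ E ] E ∈ C}
      -- The union of an empty chain is no filter, so `B` itself serves as its bound.
      ... | no ¬E = record { pred = B ; isProper = B-proper ; above = id } , λ {E} E∈C → ⊥-elim (¬E (E , E∈C))
      ... | yes (E₀ , E₀∈C) = record
        -- The union quantifies over filters and lives one universe too high to be a filter before
        -- resizing.
        { pred     = λ a → Resize _ (⋃ a)
        ; isProper = record
          { isFilter = record
            { 𝟏∈       = resize (E₀ , E₀∈C , IsFilter.𝟏∈ (Above.isFilter E₀))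
            ; ·-closed = λ x∈ y∈ → resize (product (unresize x∈) (unresize y∈))
            ; upward   = λ x≤y x∈ →
                let E , E∈C , x∈E = unresize {P = ⋃ _} x∈
                in resize (E , E∈C , IsFilter.upward (Above.isFilter E) x≤y x∈E)
            }
          ; proper = λ 𝟎∈ → let E , _ , 𝟎∈E = unresize {P = ⋃ _} 𝟎∈ in Above.proper E 𝟎∈E
          }
        ; above = λ b∈B → resize (E₀ , E₀∈C , Above.above E₀ b∈B)
        } , λ {E} E∈C a∈E → resize (E , E∈C , a∈E)
        where
        ⋃ : Pred Carrier (lsuc (c ⊔ ℓ))
        ⋃ a = ∃[ E ] (E ∈ C × a ∈ Above.pred E)

        product : ∀ {x y} → ⋃ x → ⋃ y → ⋃ (x · y)
        product (E , E∈C , x∈E) (F , F∈C , y∈F) with chain E∈C F∈C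
        ... | inj₁ E⊆F = F , F∈C , IsFilter.·-closed (Above.isFilter F) (E⊆F x∈E) y∈F
        ... | inj₂ F⊆E = E , E∈C , IsFilter.·-closed (Above.isFilter E) x∈E (F⊆E y∈F)

      zorn-applied : ∃[ m ] (∀ {E} → Above.pred m ⊆ Above.pred E →
        (Above.pred E ⊆ Above.pred m) × (Above.pred m ⊆ Above.pred E))
      zorn-applied = zorn abovePoset upperBound

      m : Above
      m = proj₁ zorn-applied

      m-maximal : ∀ {E} → Above.pred m ⊆ Above.pred E →
                  (Above.pred E ⊆ Above.pred m) × (Above.pred m ⊆ Above.pred E)
      m-maximal {E} = proj₂ zorn-applied {E}

  module MaximalFilter {c ℓ} (A : MVAlgebra c ℓ) (F : SpecM A) where
    open MVAlgebra A
    open MVProperties A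
    open SpecM F public using (filter)
    open IsProperFilter (SpecM.isProperFilter F) public using (proper)
    open FilterProperties A (IsProperFilter.isFilter (SpecM.isProperFilter F)) public

    -- By maximality, `F` together with `x` generates 0. So some power of `f · x` with `f` in `F` is
    -- 0; it splits into powers of `f` and `x`, and residuation puts the negated power of `x` above
    -- an element of `F`.
    archimedean : ∀ {x} → x ∉ filter → ∃[ n ] ∼ sq^ n x ∈ filter
    archimedean {x} x∉F = dne λ none →
      x∉F (SpecM.maximal F Gen (record { isFilter = Gen-isFilter-D ; proper = Gen-proper none })
        (λ f∈F → IsFilter.upward Gen-isFilter-D x·y≤x (D⊆Gen (_ , f∈F , ≈-refl)))
        (IsFilter.upward Gen-isFilter-D x·y≤y (D⊆Gen (_ , 𝟏∈ , ≈-refl))))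
      where
      D : Pred Carrier (c ⊔ ℓ)
      D d = ∃[ f ] (f ∈ filter × d ≈ f · x)
      open Generated A D

      Gen-isFilter-D : IsFilter A Gen
      Gen-isFilter-D = Gen-isFilter (_ , _ , 𝟏∈ , ≈-refl)
        λ (f , f∈F , p) (g , g∈F , q) → (f · g) · x , (f · g , ·-closed f∈F g∈F , ≈-refl) ,
          ≤-respʳ-≈ (≈-sym p) (·-mono x·y≤x ≤-refl) , ≤-respʳ-≈ (≈-sym q) (·-mono x·y≤y ≤-refl)

      Gen-proper : ¬ (∃[ n ] ∼ sq^ n x ∈ filter) → 𝟎 ∉ Gen
      Gen-proper none (d , (f , f∈F , d≈f·x) , n , sq≤𝟎) = none (n ,
        upward (≤-respʳ-≈ (⇒𝟎≈∼ _) (curry≤ (≤-respˡ-≈ (sq^-· n f x)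
          (≤-trans (sq^-mono n (≤-reflexive (≈-sym d≈f·x))) sq≤𝟎))))
          (sq^-closed n f∈F))

    -- The join `xⁿ ∨ y` unfolds to `(xⁿ ⇒ y) ⇒ y` and remains 1 for iterated squares `xⁿ`; once
    -- `∼ xⁿ` is in the filter, modus ponens gives `y`. With prelinearity this makes the quotient a
    -- chain.
    ∉⇒∈ : ∀ {x y} → x ∨ y ≈ 𝟏 → x ∉ filter → y ∈ filter
    ∉⇒∈ {x} {y} x∨y≈𝟏 x∉F =
      let n , ∼xⁿ∈F = archimedean x∉F
      in ∈-mp (≈𝟏⇒∈ (∨-≈𝟏-sq^ n x∨y≈𝟏)) (upward ∼x≤x⇒y ∼xⁿ∈F)

    ⋢⇒⊒ : ∀ {x y} → ¬ x ⊑ y → y ⊑ x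
    ⋢⇒⊒ = ∉⇒∈ (prelinear _ _)

  module _ {c ℓ s t} (A : MVAlgebra c ℓ) (B : MVAlgebra s t)
           (π : MVHomomorphism (MVAlgebra.raw A) (MVAlgebra.raw B))
           (surjective : ∀ y → ∃[ x ] (MVAlgebra._≈_ B (MVHomomorphism.⟦_⟧ π x) y))
           (B-simple : IsSimple B) where
    private
      module A = MVAlgebra A
      module B = MVAlgebra B
      module Aₚ = MVProperties A
      module Bₚ = MVProperties B
    open MVHomomorphism π

    𝟏-homo : ⟦ A.𝟏 ⟧ B.≈ B.𝟏
    𝟏-homo = Bₚ.≈-trans (∼-homo A.𝟎) (B.∼-cong 𝟎-homo)

    ·-homo : ∀ x y → ⟦ x A.· y ⟧ B.≈ ⟦ x ⟧ B.· ⟦ y ⟧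
    ·-homo x y = Bₚ.≈-trans (∼-homo _) (B.∼-cong (Bₚ.≈-trans (⊕-homo _ _) (Bₚ.⊕-cong (∼-homo x) (∼-homo y))))

    ⇒-homo : ∀ x y → ⟦ x A.⇒ y ⟧ B.≈ ⟦ x ⟧ B.⇒ ⟦ y ⟧
    ⇒-homo x y = Bₚ.≈-trans (⊕-homo _ _) (Bₚ.⊕-congʳ (∼-homo x))

    ∨-homo : ∀ x y → ⟦ x A.∨ y ⟧ B.≈ ⟦ x ⟧ B.∨ ⟦ y ⟧
    ∨-homo x y = Bₚ.≈-trans (⇒-homo _ _) (Bₚ.⊕-congʳ (B.∼-cong (⇒-homo x y)))

    -- Maximality comes from simplicity of `B`: the image of a larger filter induces a trivial or
    -- total congruence. A total one yields `b` in the filter with image 0, but then `∼ b` is in the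
    -- kernel, against properness.
    kernelFilter : SpecM A
    kernelFilter = record
      { filter         = λ a → Resize (c ⊔ ℓ) (⟦ a ⟧ B.≈ B.𝟏)
      ; isProperFilter = record
        { isFilter = record
          { 𝟏∈       = resize 𝟏-homo
          ; ·-closed = λ {x} {y} x∈ y∈ → resize (Bₚ.≈-trans (·-homo x y)
              (Bₚ.≈-trans (Bₚ.·-cong (unresize x∈) (unresize y∈)) (Bₚ.·-identityˡ B.𝟏)))
          ; upward   = λ {x} {y} x≤y x∈ → resize (Bₚ.≈-trans
              (Bₚ.≈-sym (Bₚ.∼𝟏⊕x≈x ⟦ y ⟧))
              (Bₚ.≈-trans (Bₚ.⊕-congʳ (B.∼-cong (Bₚ.≈-sym (unresize x∈))))
                (Bₚ.≈-trans (Bₚ.≈-sym (⇒-homo x y)) (Bₚ.≈-trans (⟦⟧-cong x≤y) 𝟏-homo))))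
          }
        ; proper = λ 𝟎∈ → IsSimple.nontrivial B-simple (Bₚ.≈-trans (Bₚ.≈-sym 𝟎-homo) (unresize 𝟎∈))
        }
      ; maximal = λ F F-proper kernel⊆F {a} a∈F →
          resize (Maximality.kernel F F-proper kernel⊆F a∈F)
      }
      where
      module Maximality (F : Pred A.Carrier (c ⊔ ℓ)) (F-proper : IsProperFilter A F)
                        (kernel⊆F : ∀ {a} → Resize (c ⊔ ℓ) (⟦ a ⟧ B.≈ B.𝟏) → a ∈ F) where
        open IsProperFilter F-proper using (isFilter; proper)
        open IsFilter isFilter

        preimage : B.Carrier → Set _
        preimage u = ∃[ a ] (a ∈ F × ⟦ a ⟧ B.≈ u)

        image : Pred B.Carrier (s ⊔ t)
        image u = Resize _ (preimage u)

        image-isFilter : IsFilter B image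
        image-isFilter = record
          { 𝟏∈       = resize (A.𝟏 , 𝟏∈ , 𝟏-homo)
          ; ·-closed = λ u∈ v∈ →
              let a , a∈F , πa≈u = unresize {P = preimage _} u∈
                  b , b∈F , πb≈v = unresize {P = preimage _} v∈
              in resize (a A.· b , ·-closed a∈F b∈F , Bₚ.≈-trans (·-homo a b) (Bₚ.·-cong πa≈u πb≈v))
          ; upward   = λ {u} {v} u≤v u∈ →
              let a , a∈F , πa≈u = unresize {P = preimage _} u∈
                  b , πb≈v = surjective v
              -- An arbitrary preimage `b` of `v` may lie outside `F`; joining it with `a` moves it
              -- into `F`, and the image is still `u ∨ v = v`.
              in resize (a A.∨ b , upward Aₚ.x≤x∨y a∈F , Bₚ.≈-trans (∨-homo a b)
                   (Bₚ.≈-trans (Bₚ.⊕-cong (B.∼-cong (Bₚ.⊕-cong (B.∼-cong πa≈u) πb≈v)) πb≈v)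
                     (Bₚ.x≤y⇒x∨y≈y u≤v)))
          }

        module Image = FilterProperties B image-isFilter

        kernel : ∀ {a} → a ∈ F → ⟦ a ⟧ B.≈ B.𝟏
        kernel {a} a∈F with IsSimple.congruences B-simple _ Image.congruence
        ... | inj₁ trivial = trivial ⟦ a ⟧ B.𝟏
              (Image.≤⇒⊑ Bₚ.x≤𝟏 , Image.∈⇒⊑ (resize (a , a∈F , Bₚ.≈-refl)))
        ... | inj₂ total =
          let b , b∈F , πb≈𝟎 = unresize {P = preimage _} (Image.∈-resp-≈ (Bₚ.𝟏⇒x≈x B.𝟎) (proj₁ (total B.𝟏 B.𝟎)))
              ∼b∈F = kernel⊆F (resize (Bₚ.≈-trans (∼-homo b) (B.∼-cong πb≈𝟎)))
          in ⊥-elim (proper (upward Aₚ.x·∼x≤𝟎 (·-closed b∈F ∼b∈F)))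

  -- The kernels of the projections onto the simple factors are maximal filters, so such a `z` has
  -- value 1 in every factor.
  spectrum-separates : ∀ {c ℓ i s t} (A : MVAlgebra c ℓ) → IsSemisimple i s t A →
    let open MVAlgebra A in ∀ {z} → (∀ (F : SpecM A) → z ∈ SpecM.filter F) → z ≈ 𝟏
  spectrum-separates A semisimple z∈all = separating λ j →
    B.≈-trans j (unresize (z∈all (K j))) (B.≈-sym j (𝟏-homo A (factor j) (projection j) (surj j) (simple j)))
    where
    open IsSemisimple semisimple
    module B j = MVProperties (factor j)

    surj : ∀ j y → _
    surj j y = let x , p = surjective j y in x , p (MVProperties.≈-refl A)

    K : ∀ j → SpecM A
    K j = kernelFilter A (factor j) (projection j) (surj j) (simple j)

-- Rational arithmetic

module _ where
  open import Data.Rational using (_≤_; _<_)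

  -- Turns a linear inequality into a ring identity between differences, which the solver settles.
  ≤-transport : ∀ {a b p q} → a ≤ b → b - a ≡ q - p → p ≤ q
  ≤-transport {a} {b} {p} {q} a≤b eq = begin
    p             ≡⟨ solve 2 (λ a p → p := a :+ (p :- a)) refl a p ⟩
    a + (p - a)   ≤⟨ ℚₚ.+-monoˡ-≤ (p - a) a≤b ⟩
    b + (p - a)   ≡⟨ solve 3 (λ a b p → b :+ (p :- a) := (b :- a) :+ p) refl a b p ⟩
    (b - a) + p   ≡⟨ cong (_+ p) eq ⟩
    (q - p) + p   ≡⟨ solve 2 (λ p q → (q :- p) :+ p := q) refl p q ⟩
    q             ∎
    where open ℚₚ.≤-Reasoning

  <-transport : ∀ {a b p q} → a < b → b - a ≡ q - p → p < q
  <-transport {a} {b} {p} {q} a<b eq = begin-strict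
    p             ≡⟨ solve 2 (λ a p → p := a :+ (p :- a)) refl a p ⟩
    a + (p - a)   <⟨ ℚₚ.+-monoˡ-< (p - a) a<b ⟩
    b + (p - a)   ≡⟨ solve 3 (λ a b p → b :+ (p :- a) := (b :- a) :+ p) refl a b p ⟩
    (b - a) + p   ≡⟨ cong (_+ p) eq ⟩
    (q - p) + p   ≡⟨ solve 2 (λ p q → (q :- p) :+ p := q) refl p q ⟩
    q             ∎
    where open ℚₚ.≤-Reasoning

  0<1 : 0ℚ < 1ℚ
  0<1 = ℚₚ.positive⁻¹ 1ℚ

  multiple : ℕ → ℚ → ℚ
  multiple zero    p = 0ℚ
  multiple (suc n) p = p + multiple n p

  double^ : ℕ → ℚ → ℚ
  double^ zero    p = p
  double^ (suc n) p = double^ n (p + p)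

  multiple-mono : ∀ n {p q} → p ≤ q → multiple n p ≤ multiple n q
  multiple-mono zero    p≤q = ℚₚ.≤-refl
  multiple-mono (suc n) p≤q = ℚₚ.+-mono-≤ p≤q (multiple-mono n p≤q)

  multiple≤double^ : ∀ n {p} → 0ℚ < p → multiple (suc n) p ≤ double^ n p
  multiple≤double^ zero    {p} 0<p = ℚₚ.≤-reflexive (ℚₚ.+-identityʳ p)
  multiple≤double^ (suc n) {p} 0<p = begin
    p + (p + multiple n p)           ≡⟨ ℚₚ.+-assoc p p _ ⟨
    (p + p) + multiple n p           ≤⟨ ℚₚ.+-monoʳ-≤ (p + p) (multiple-mono n p≤p+p) ⟩
    (p + p) + multiple n (p + p)     ≤⟨ multiple≤double^ n (ℚₚ.+-mono-< 0<p 0<p) ⟩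
    double^ n (p + p)                ∎
    where
    open ℚₚ.≤-Reasoning
    p≤p+p : p ≤ p + p
    p≤p+p = ≤-transport (ℚₚ.<⇒≤ 0<p) (solve 1 (λ p → p :- con 0ℚ := (p :+ p) :- p) refl p)

  toℚᵘ-multiple : ∀ n p → ℚ.toℚᵘ (multiple n p) ℚᵘ.≃ ℚᵘ.mkℚᵘ (ℤ.+ n ℤ.* ℚ.↥ p) (ℚ.denominator-1 p)
  toℚᵘ-multiple zero    p@record{} = ℚᵘ.*≡* refl
  toℚᵘ-multiple (suc n) p@record{} = ℚᵘₚ.≃-trans (ℚₚ.toℚᵘ-homo-+ p (multiple n p))
    (ℚᵘₚ.≃-trans (ℚᵘₚ.+-congʳ (ℚ.toℚᵘ p) (toℚᵘ-multiple n p))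
      (ℚᵘ.*≡* (ℤS.solve 3 (λ n a d → (a ℤS.:* d ℤS.:+ (n ℤS.:* a) ℤS.:* d) ℤS.:* d ℤS.:=
         ((ℤS.con (ℤ.+ 1) ℤS.:+ n) ℤS.:* a) ℤS.:* (d ℤS.:* d)) refl (ℤ.+ n) (ℚ.↥ p) (ℚ.↧ p))))
    where module ℤS = Data.Integer.Solver.+-*-Solver

  archimedeanℚ : ∀ {p} → 0ℚ < p → ∃[ n ] 1ℚ ≤ multiple (suc n) p
  archimedeanℚ {ℚ.mkℚ (ℤ.+ zero) d _} (ℚ.*<* (ℤ.+<+ ()))
  archimedeanℚ {ℚ.mkℚ (ℤ.-[1+ _ ]) d _} (ℚ.*<* ())
  -- Here `p` is (m+1)/(d+1), so d+1 copies of it sum to m+1.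
  archimedeanℚ {p@(ℚ.mkℚ (ℤ.+ suc m) d _)} _ = d , ℚₚ.toℚᵘ-cancel-≤
    (ℚᵘₚ.≤-respʳ-≃ (ℚᵘₚ.≃-sym (toℚᵘ-multiple (suc d) p))
      (ℚᵘ.*≤* (≡.subst₂ ℤ._≤_ (≡.sym (ℤₚ.*-identityˡ (ℤ.+ suc d))) (≡.sym (ℤₚ.*-identityʳ _))
        (ℤ.+≤+ (ℕₚ.m≤m*n (suc d) (suc m))))))

  -- Finitely many doublings carry any positive tolerance past 1, so the recursion from ε to 2ε is
  -- well founded.
  halving : ∀ {a} (P : ℚ → Set a) → (∀ {ε} → 1ℚ ≤ ε → P ε) →
            (∀ {ε} → 0ℚ < ε → P (ε + ε) → P ε) → ∀ {ε} → 0ℚ < ε → P ε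
  halving P large half 0<ε =
    let n , 1≤nε = archimedeanℚ 0<ε
    in go n 0<ε (ℚₚ.≤-trans 1≤nε (multiple≤double^ n 0<ε))
    where
    go : ∀ n {ε} → 0ℚ < ε → 1ℚ ≤ double^ n ε → P ε
    go zero    0<ε 1≤ε = large 1≤ε
    go (suc n) 0<ε 1≤  = half 0<ε (go n (ℚₚ.+-mono-< 0<ε 0<ε) 1≤)

open import Data.Rational using (_+_; _-_; _*_; _⊓_)
open Data.Rational.Solver.+-*-Solver using (solve; _:=_; _:+_; _:-_; _:*_; con)

open UnitRational using (value; 0≤; ≤1)

-- Truncated arithmetic on the rational unit interval

infixl 6 _⊕ᵤ_
infixl 7 _·ᵤ_
infix  8 ∼ᵤ_

0ᵤ 1ᵤ ½ᵤ : UnitRational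
0ᵤ = unit 0ℚ ℚₚ.≤-refl (ℚₚ.<⇒≤ 0<1)
1ᵤ = unit 1ℚ (ℚₚ.<⇒≤ 0<1) ℚₚ.≤-refl
½ᵤ = unit ½ (ℚₚ.<⇒≤ (ℚₚ.positive⁻¹ ½)) (ℚₚ.≤ᵇ⇒≤ _)

_⊕ᵤ_ _·ᵤ_ mean : UnitRational → UnitRational → UnitRational
∼ᵤ_ : UnitRational → UnitRational

r ⊕ᵤ s = unit ((value r + value s) ⊓ 1ℚ)
  (ℚₚ.⊓-glb {0ℚ} {value r + value s} (ℚₚ.+-mono-≤ (0≤ r) (0≤ s)) (ℚₚ.<⇒≤ 0<1))
  (ℚₚ.p⊓q≤q (value r + value s) 1ℚ)

∼ᵤ r = unit (1ℚ - value r)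
  (≤-transport (≤1 r) (solve 1 (λ r → con 1ℚ :- r := (con 1ℚ :- r) :- con 0ℚ) refl (value r)))
  (≤-transport (0≤ r) (solve 1 (λ r → r :- con 0ℚ := con 1ℚ :- (con 1ℚ :- r)) refl (value r)))

r ·ᵤ s = ∼ᵤ (∼ᵤ r ⊕ᵤ ∼ᵤ s)

mean r s = unit (½ * (value r + value s))
  (ℚₚ.*-monoˡ-≤-nonNeg ½ (ℚₚ.+-mono-≤ (0≤ r) (0≤ s)))
  (ℚₚ.*-monoˡ-≤-nonNeg ½ (ℚₚ.+-mono-≤ (≤1 r) (≤1 s)))

⊕ᵤ-lower : ∀ r s {p} → p ℚ.≤ value r + value s → p ℚ.≤ 1ℚ → p ℚ.≤ value (r ⊕ᵤ s)
⊕ᵤ-lower r s {p} = ℚₚ.⊓-glb {p} {value r + value s} {1ℚ}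

⊕ᵤ-lower-< : ∀ r s {p} → p ℚ.< value r + value s → p ℚ.< 1ℚ → p ℚ.< value (r ⊕ᵤ s)
⊕ᵤ-lower-< r s {p} p<r+s p<1 with ℚₚ.⊓-sel (value r + value s) 1ℚ
... | inj₁ eq = subst (p ℚ.<_) (≡.sym eq) p<r+s
... | inj₂ eq = subst (p ℚ.<_) (≡.sym eq) p<1

⊕ᵤ-upper : ∀ r s → value (r ⊕ᵤ s) ℚ.≤ value r + value s
⊕ᵤ-upper r s = ℚₚ.p⊓q≤p (value r + value s) 1ℚ

·ᵤ-lower : ∀ r s → (value r + value s) - 1ℚ ℚ.≤ value (r ·ᵤ s)
·ᵤ-lower r s = ≤-transport (⊕ᵤ-upper (∼ᵤ r) (∼ᵤ s))
  (solve 3 (λ r s m → ((con 1ℚ :- r) :+ (con 1ℚ :- s)) :- m := (con 1ℚ :- m) :- ((r :+ s) :- con 1ℚ))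
    refl (value r) (value s) (value (∼ᵤ r ⊕ᵤ ∼ᵤ s)))

·ᵤ-upper : ∀ r s {p} → 0ℚ ℚ.≤ p → (value r + value s) - 1ℚ ℚ.≤ p → value (r ·ᵤ s) ℚ.≤ p
·ᵤ-upper r s {p} 0≤p r+s-1≤p = ≤-transport
  (⊕ᵤ-lower (∼ᵤ r) (∼ᵤ s)
    (≤-transport r+s-1≤p
      (solve 3 (λ r s p → p :- ((r :+ s) :- con 1ℚ) := ((con 1ℚ :- r) :+ (con 1ℚ :- s)) :- (con 1ℚ :- p))
        refl (value r) (value s) p))
    (≤-transport 0≤p (solve 1 (λ p → p :- con 0ℚ := con 1ℚ :- (con 1ℚ :- p)) refl p)))
  (solve 2 (λ p m → m :- (con 1ℚ :- p) := p :- (con 1ℚ :- m)) refl p (value (∼ᵤ r ⊕ᵤ ∼ᵤ s)))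

½<1 : ½ ℚ.< 1ℚ
½<1 = toWitness {a? = ½ ℚₚ.<? 1ℚ} _

½-positive : ∀ {p} → 0ℚ ℚ.< p → 0ℚ ℚ.< ½ * p
½-positive = ℚₚ.*-monoʳ-<-pos ½

positive-difference : ∀ {p q} → p ℚ.< q → 0ℚ ℚ.< q - p
positive-difference {p} {q} p<q = <-transport p<q (solve 2 (λ p q → q :- p := (q :- p) :- con 0ℚ) refl p q)

p-δ<p : ∀ p {δ} → 0ℚ ℚ.< δ → p - δ ℚ.< p
p-δ<p p {δ} 0<δ = <-transport 0<δ (solve 2 (λ p δ → δ :- con 0ℚ := p :- (p :- δ)) refl p δ)

-- Pavelka algebras and their real values

module PavelkaProperties {c ℓ} (P : PavelkaAlgebra c ℓ) where
  open PavelkaAlgebra P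
  open MVProperties mvReduct

  const-0ᵤ : const 0ᵤ ≈ 𝟎
  const-0ᵤ = const-𝟎 0ᵤ refl

  const-1ᵤ : const 1ᵤ ≈ 𝟏
  const-1ᵤ = ≈-trans (≈-sym (const-∼ 0ᵤ 1ᵤ refl)) (∼-cong const-0ᵤ)

  ∼-const : ∀ r → ∼ const r ≈ const (∼ᵤ r)
  ∼-const r = const-∼ r (∼ᵤ r) refl

  ⊕-const : ∀ r s → const r ⊕ const s ≈ const (r ⊕ᵤ s)
  ⊕-const r s = const-⊕ r s (r ⊕ᵤ s) refl

  ⇒-const : ∀ r s → const r ⇒ const s ≈ const (∼ᵤ r ⊕ᵤ s)
  ⇒-const r s = ≈-trans (⊕-congʳ (∼-const r)) (⊕-const (∼ᵤ r) s)

  ·-const : ∀ r s → const r · const s ≈ const (r ·ᵤ s)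
  ·-const r s = ≈-trans (∼-cong (≈-trans (⊕-cong (∼-const r) (∼-const s)) (⊕-const (∼ᵤ r) (∼ᵤ s)))) (∼-const _)

  const-≤ : ∀ {r s} → value r ℚ.≤ value s → const r ≤ const s
  const-≤ {r} {s} r≤s = ≈-trans (⊕-congʳ (∼-const r)) (≈-trans (const-⊕ (∼ᵤ r) s 1ᵤ
    (ℚₚ.p≥q⇒p⊓q≡q {(1ℚ - value r) + value s} {1ℚ} (≤-transport r≤s
      (solve 2 (λ r s → s :- r := ((con 1ℚ :- r) :+ s) :- con 1ℚ) refl (value r) (value s))))) const-1ᵤ)

  const-≥½⊕½ : 𝟏 ≤ const ½ᵤ ⊕ const ½ᵤ
  const-≥½⊕½ = ≤-reflexive (≈-sym (≈-trans (const-⊕ ½ᵤ ½ᵤ 1ᵤ refl) const-1ᵤ))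

  -- The Łukasiewicz square of (1+s)/2 is s, and (1+s)/2 stays below 1; iterating it gives the root.
  root : ∀ n s → value s ℚ.< 1ℚ → ∃[ u ] (value u ℚ.< 1ℚ × const s ≤ sq^ n (const u))
  root zero    s s<1 = s , s<1 , ≤-refl
  root (suc n) s s<1 =
    let u , u<1 , p = root n (mean 1ᵤ s) (ℚₚ.*-monoʳ-<-pos ½ (ℚₚ.+-monoʳ-< 1ℚ s<1))
    in u , u<1 , ≤-trans
         (≤-respʳ-≈ (≈-sym (·-const (mean 1ᵤ s) (mean 1ᵤ s)))
           (const-≤ {s} {mean 1ᵤ s ·ᵤ mean 1ᵤ s} (ℚₚ.≤-trans
             (ℚₚ.≤-reflexive
               (solve 1 (λ s → s := (con ½ :* (con 1ℚ :+ s) :+ con ½ :* (con 1ℚ :+ s)) :- con 1ℚ)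
                  refl (value s)))
             (·ᵤ-lower (mean 1ᵤ s) (mean 1ᵤ s)))))
         (·-mono p p)

-- Real values in the quotient by a maximal filter

module Spectrum (em : ∀ {ℓ} → ExcludedMiddle ℓ) {c ℓ} (P : PavelkaAlgebra c ℓ)
                (F : SpecM (PavelkaAlgebra.mvReduct P)) where
  open Classical em
  open PavelkaAlgebra P
  open MVProperties mvReduct
  open PavelkaProperties P
  open MaximalFilter mvReduct F public

  -- Squaring a constant doubles its distance from 1, so repeated squaring reaches 0, which a proper
  -- filter excludes.
  const∉ : ∀ u → value u ℚ.< 1ℚ → const u ∉ filter
  const∉ u u<1 = halving Bound large half (positive-difference u<1) u
    (ℚₚ.≤-reflexive (solve 1 (λ u → u :+ (con 1ℚ :- u) := con 1ℚ) refl (value u)))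
    where
    Bound : ℚ → Set _
    Bound ε = ∀ u → value u + ε ℚ.≤ 1ℚ → const u ∉ filter

    zero∉ : ∀ u → value u ℚ.≤ 0ℚ → const u ∉ filter
    zero∉ u u≤0 u∈F = proper (upward (≤-respʳ-≈ const-0ᵤ (const-≤ u≤0)) u∈F)

    large : ∀ {ε} → 1ℚ ℚ.≤ ε → Bound ε
    large {ε} 1≤ε u u+ε≤1 = zero∉ u (≤-transport (ℚₚ.+-mono-≤ 1≤ε u+ε≤1)
      (solve 2 (λ u ε → (ε :+ con 1ℚ) :- (con 1ℚ :+ (u :+ ε)) := con 0ℚ :- u) refl (value u) ε))

    half : ∀ {ε} → 0ℚ ℚ.< ε → Bound (ε + ε) → Bound ε
    half {ε} 0<ε bound u u+ε≤1 u∈F with ℚₚ.≤-total (ε + ε) 1ℚ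
    ... | inj₁ 2ε≤1 = bound (u ·ᵤ u)
            (≤-transport (·ᵤ-upper u u {1ℚ - (ε + ε)}
              (≤-transport 2ε≤1 (solve 1 (λ ε → con 1ℚ :- (ε :+ ε) := (con 1ℚ :- (ε :+ ε)) :- con 0ℚ) refl ε))
              (≤-transport (ℚₚ.+-mono-≤ u+ε≤1 u+ε≤1)
                (solve 2 (λ u ε → (con 1ℚ :+ con 1ℚ) :- ((u :+ ε) :+ (u :+ ε)) :=
                   (con 1ℚ :- (ε :+ ε)) :- ((u :+ u) :- con 1ℚ))
                   refl (value u) ε)))
              (solve 2 (λ v ε → (con 1ℚ :- (ε :+ ε)) :- v := con 1ℚ :- (v :+ (ε :+ ε)))
                 refl (value (u ·ᵤ u)) ε))
            (∈-resp-≈ (·-const u u) (·-closed u∈F u∈F))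
    ... | inj₂ 1≤2ε = zero∉ (u ·ᵤ u)
            (·ᵤ-upper u u ℚₚ.≤-refl
              (≤-transport (ℚₚ.+-mono-≤ 1≤2ε (ℚₚ.+-mono-≤ u+ε≤1 u+ε≤1))
                (solve 2 (λ u ε → ((ε :+ ε) :+ (con 1ℚ :+ con 1ℚ)) :- (con 1ℚ :+ ((u :+ ε) :+ (u :+ ε))) :=
                   con 0ℚ :- ((u :+ u) :- con 1ℚ))
                   refl (value u) ε)))
            (∈-resp-≈ (·-const u u) (·-closed u∈F u∈F))

  const-reflects-≤ : ∀ {r s} → const r ⊑ const s → value r ℚ.≤ value s
  const-reflects-≤ {r} {s} r⊑s = ℚₚ.≮⇒≥ λ s<r →
    const∉ (∼ᵤ r ⊕ᵤ s)
      (ℚₚ.≤-<-trans (⊕ᵤ-upper (∼ᵤ r) s)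
        (<-transport s<r (solve 2 (λ r s → r :- s := con 1ℚ :- ((con 1ℚ :- r) :+ s)) refl (value r) (value s))))
      (∈-resp-≈ (⇒-const r s) r⊑s)

  -- Bisection: the quotient is a chain, so `x` is comparable with the midpoint of any bracket.
  bracket : ∀ x {ε} → 0ℚ ℚ.< ε →
            ∃[ r ] ∃[ s ] (const r ⊑ x × x ⊑ const s × value s ℚ.≤ value r + ε)
  bracket x = halving _ large half
    where
    large : ∀ {ε} → 1ℚ ℚ.≤ ε → ∃[ r ] ∃[ s ] (const r ⊑ x × x ⊑ const s × value s ℚ.≤ value r + ε)
    large 1≤ε = 0ᵤ , 1ᵤ , ≤⇒⊑ (≤-respˡ-≈ (≈-sym const-0ᵤ) 𝟎≤x) , ≤⇒⊑ (≤-respʳ-≈ (≈-sym const-1ᵤ) x≤𝟏) ,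
      ℚₚ.≤-trans 1≤ε (ℚₚ.≤-reflexive (≡.sym (ℚₚ.+-identityˡ _)))

    half : ∀ {ε} → 0ℚ ℚ.< ε →
           ∃[ r ] ∃[ s ] (const r ⊑ x × x ⊑ const s × value s ℚ.≤ value r + (ε + ε)) →
           ∃[ r ] ∃[ s ] (const r ⊑ x × x ⊑ const s × value s ℚ.≤ value r + ε)
    half {ε} _ (r , s , r⊑x , x⊑s , s≤r+2ε) with em {P = const (mean r s) ⊑ x}
    ... | yes m⊑x = mean r s , s , m⊑x , x⊑s , ≤-transport (ℚₚ.*-monoˡ-≤-nonNeg ½ s≤r+2ε)
            (solve 3 (λ r s ε → con ½ :* (r :+ (ε :+ ε)) :- con ½ :* s := (con ½ :* (r :+ s) :+ ε) :- s)
               refl (value r) (value s) ε)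
    ... | no ¬m⊑x = r , mean r s , r⊑x , ⋢⇒⊒ ¬m⊑x , ≤-transport (ℚₚ.*-monoˡ-≤-nonNeg ½ s≤r+2ε)
            (solve 3 (λ r s ε → con ½ :* (r :+ (ε :+ ε)) :- con ½ :* s := (r :+ ε) :- con ½ :* (r :+ s))
               refl (value r) (value s) ε)

  -- If `z` is outside, some negated power of `z` is inside. A constant below 1 whose same power is
  -- at least ½ bounds `z` from below, which forces the constant `∼ ½` into the filter. The choice ½
  -- keeps both it and its negation below 1.
  limit : ∀ {z} → (∀ u → value u ℚ.< 1ℚ → const u ⊑ z) → z ∈ filter
  limit {z} below = dne λ z∉F →
    let n , ∼zⁿ∈F     = archimedean z∉F
        u , u<1 , ½≤uⁿ = root n ½ᵤ ½<1
        ½⊑zⁿ           = ⊑-trans (≤⇒⊑ ½≤uⁿ) (sq^-mono-⊑ n (below u u<1))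
    in const∉ (∼ᵤ ½ᵤ) ½<1
         (∈-resp-≈ (∼-const ½ᵤ) (∈-mp (∼-anti-⊑ ½⊑zⁿ) ∼zⁿ∈F))

  approximate : ∀ {x w} → (∀ r q → const r ⊑ x → value q ℚ.< value r → const q ⊑ w) → x ⊑ w
  approximate {x} {w} below = limit λ u u<1 →
    let ε = ½ * (1ℚ - value u)
        0<ε = ½-positive (positive-difference u<1)
        r , s , r⊑x , x⊑s , s≤r+ε = bracket x 0<ε
    in cases u r s ε 0<ε refl r⊑x x⊑s s≤r+ε (ℚₚ.≤-total (value r) ε)
    where
    cases : ∀ u r s ε → 0ℚ ℚ.< ε → ε ≡ ½ * (1ℚ - value u) →
           const r ⊑ x → x ⊑ const s → value s ℚ.≤ value r + ε →
           (value r ℚ.≤ ε) ⊎ (ε ℚ.≤ value r) → const u ⊑ x ⇒ w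
    -- Here r - ε may be negative, hence no constant; but s is at most 2ε = 1 - u, so `∼ x` alone is
    -- at least u.
    cases u r s ε 0<ε refl r⊑x x⊑s s≤r+ε (inj₁ r≤ε) =
      ⊑-trans (⊑-trans (⊑-respʳ-≈ (≈-sym (∼-const s)) (≤⇒⊑ (const-≤ u≤1-s))) (∼-anti-⊑ x⊑s)) (≤⇒⊑ ∼x≤x⇒y)
      where
      u≤1-s : value u ℚ.≤ 1ℚ - value s
      u≤1-s = ≤-transport (ℚₚ.+-mono-≤ s≤r+ε r≤ε)
        (solve 3 (λ u r s → let ε = con ½ :* (con 1ℚ :- u) in
           ((r :+ ε) :+ ε) :- (s :+ r) := (con 1ℚ :- s) :- u) refl (value u) (value r) (value s))
    cases u r s ε 0<ε refl r⊑x x⊑s s≤r+ε (inj₂ ε≤r) =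
      ⊑-trans (⊑-respʳ-≈ (≈-sym (⇒-const s q)) (≤⇒⊑ (const-≤ u≤s⇒q)))
        (⊕-mono-⊑ (∼-anti-⊑ x⊑s) (below r q r⊑x q<r))
      where
      q : UnitRational
      q = unit (value r - ε)
        (≤-transport ε≤r (solve 2 (λ r ε → r :- ε := (r :- ε) :- con 0ℚ) refl (value r) ε))
        (ℚₚ.≤-trans (≤-transport (ℚₚ.<⇒≤ 0<ε)
          (solve 2 (λ r ε → ε :- con 0ℚ := r :- (r :- ε))
             refl (value r) ε)) (≤1 r))
      q<r : value q ℚ.< value r
      q<r = <-transport 0<ε (solve 2 (λ r ε → ε :- con 0ℚ := r :- (r :- ε)) refl (value r) ε)
      u≤s⇒q : value u ℚ.≤ value (∼ᵤ s ⊕ᵤ q)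
      u≤s⇒q = ⊕ᵤ-lower (∼ᵤ s) q (≤-transport s≤r+ε
        (solve 3 (λ u r s → let ε = con ½ :* (con 1ℚ :- u) in
           (r :+ ε) :- s := ((con 1ℚ :- s) :+ (r :- ε)) :- u) refl (value u) (value r) (value s)))
        (≤1 u)

  -- Subtract from t an upper bound r′ of `x`: residuation makes the truncated difference a lower
  -- bound of `y`. A bracket of width half of t - q loses less than the available slack.
  ⊕-split : ∀ {t q x y} → const t ⊑ x ⊕ y → q ℚ.< value t →
            ∃[ r ] ∃[ s ] (const r ⊑ x × const s ⊑ y × q ℚ.< value r + value s)
  ⊕-split {t} {q} {x} {y} t⊑x⊕y q<t =
    let ε = ½ * (value t - q)
        r , r′ , r⊑x , x⊑r′ , r′≤r+ε = bracket x (½-positive (positive-difference q<t))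
        s = t ·ᵤ ∼ᵤ r′
    in r , s , r⊑x , s⊑y r′ x⊑r′ , ℚₚ.<-≤-trans
         (<-transport (ℚₚ.+-mono-≤-< r′≤r+ε (½-positive (positive-difference q<t)))
           (solve 4 (λ r r′ t q → let ε = con ½ :* (t :- q) in
              ((r :+ ε) :+ ε) :- (r′ :+ con 0ℚ) := (r :+ ((t :+ (con 1ℚ :- r′)) :- con 1ℚ)) :- q)
              refl (value r) (value r′) (value t) q))
         (ℚₚ.+-monoʳ-≤ (value r) (·ᵤ-lower t (∼ᵤ r′)))
    where
    s⊑y : ∀ r′ → x ⊑ const r′ → const (t ·ᵤ ∼ᵤ r′) ⊑ y
    s⊑y r′ x⊑r′ = ⊑-respˡ-≈ (≈-trans (·-cong ≈-refl (∼-const r′)) (·-const t (∼ᵤ r′)))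
      (uncurry⊑ (⊑-respʳ-≈ (⊕-congʳ (≈-sym (∼-involutive _))) (⊑-trans t⊑x⊕y (⊕-monoˡ-⊑ x⊑r′))))

  valueOf : Carrier → 𝕀 (c ⊔ ℓ)
  valueOf x = record
    { cut      = λ q → ∃[ r ] (q ℚ.< value r × const r ⊑ x)
    ; negative = λ q<0 → 0ᵤ , q<0 , 0⊑
    ; bounded  = λ (r , q<r , _) → ℚₚ.<-≤-trans q<r (≤1 r)
    ; downward = λ p<q (r , q<r , r⊑x) → r , ℚₚ.<-trans p<q q<r , r⊑x
    ; open-cut = λ (r , q<r , r⊑x) →
        let m , q<m , m<r = ℚₚ.<-dense q<r in m , q<m , r , m<r , r⊑x
    }
    where
    0⊑ : const 0ᵤ ⊑ x
    0⊑ = ≤⇒⊑ (≤-respˡ-≈ (≈-sym const-0ᵤ) 𝟎≤x)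

  valueOf-mono : ∀ {x y} → x ⊑ y → valueOf x ≤ᵢ valueOf y
  valueOf-mono x⊑y (r , q<r , r⊑x) = r , q<r , ⊑-trans r⊑x x⊑y

  valueOf-reflects : ∀ {x y} → valueOf x ≤ᵢ valueOf y → x ⊑ y
  valueOf-reflects {x} {y} vx≤vy = approximate λ r q r⊑x q<r →
    let s , q<s , s⊑y = vx≤vy (r , q<r , r⊑x)
    in ⊑-trans (≤⇒⊑ (const-≤ (ℚₚ.<⇒≤ q<s))) s⊑y

  valueOf-⊕ : ∀ x y → valueOf (x ⊕ y) ≈ᵢ (valueOf x ⊕ᵢ valueOf y)
  valueOf-⊕ x y = split , combine
    where
    split : valueOf (x ⊕ y) ≤ᵢ (valueOf x ⊕ᵢ valueOf y)
    split {q} (t , q<t , t⊑x⊕y) =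
      let r , s , r⊑x , s⊑y , q<r+s = ⊕-split t⊑x⊕y q<t
          -- Half the excess is removed from each bound: both become strict and their sum is exactly
          -- q.
          δ   = ½ * ((value r + value s) - q)
          0<δ = ½-positive (positive-difference q<r+s)
      in ℚₚ.<-≤-trans q<t (≤1 t) , value r - δ , value s - δ ,
         (r , p-δ<p (value r) 0<δ , r⊑x) , (s , p-δ<p (value s) 0<δ , s⊑y) ,
         ℚₚ.≤-reflexive (solve 3 (λ r s q → let δ = con ½ :* ((r :+ s) :- q) in
           q := (r :- δ) :+ (s :- δ)) refl (value r) (value s) q)

    combine : (valueOf x ⊕ᵢ valueOf y) ≤ᵢ valueOf (x ⊕ y)
    combine {q} (q<1 , a , b , (r , a<r , r⊑x) , (s , b<s , s⊑y) , q≤a+b) =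
      r ⊕ᵤ s , ⊕ᵤ-lower-< r s (ℚₚ.≤-<-trans q≤a+b (ℚₚ.+-mono-< a<r b<s)) q<1 ,
      ⊑-respˡ-≈ (⊕-const r s) (⊕-mono-⊑ r⊑x s⊑y)

  valueOf-∼ : ∀ x → valueOf (∼ x) ≈ᵢ (∼ᵢ valueOf x)
  valueOf-∼ x = to , from
    where
    to : valueOf (∼ x) ≤ᵢ (∼ᵢ valueOf x)
    to (r , q<r , r⊑∼x) = value r , q<r , λ (s , 1-r<s , s⊑x) →
      ℚₚ.<-irrefl refl (ℚₚ.<-≤-trans 1-r<s (const-reflects-≤ {s} {∼ᵤ r} (⊑-respʳ-≈ (∼-const r)
        (⊑-trans (⊑-respʳ-≈ (≈-sym (∼-involutive x)) s⊑x) (∼-anti-⊑ r⊑∼x)))))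

    from : (∼ᵢ valueOf x) ≤ᵢ valueOf (∼ x)
    from {q} (r , q<r , 1-r∉) with q ℚₚ.<? 0ℚ
    -- Only rationals in [0,1] name constants, so negative q is separated before choosing m between
    -- q and r.
    ... | yes q<0 = 𝕀.negative (valueOf (∼ x)) q<0
    ... | no q≮0 = m , q<m , dne λ m⋢∼x → 1-r∉ (∼ᵤ m ,
            <-transport m<r (solve 2 (λ m r → r :- m := (con 1ℚ :- m) :- (con 1ℚ :- r)) refl (value m) r) ,
            ⊑-respˡ-≈ (∼-const m) (⊑-respʳ-≈ (∼-involutive x) (∼-anti-⊑ (⋢⇒⊒ m⋢∼x))))
      where
      between = ℚₚ.<-dense q<r
      q<m = proj₁ (proj₂ between)
      m<r = proj₂ (proj₂ between)
      m : UnitRational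
      m = unit (proj₁ between) (ℚₚ.<⇒≤ (ℚₚ.≤-<-trans (ℚₚ.≮⇒≥ q≮0) q<m))
        (ℚₚ.<⇒≤ (𝕀.bounded (∼ᵢ valueOf x) (r , m<r , 1-r∉)))

  valueOf-𝟎 : valueOf 𝟎 ≈ᵢ 0ᵢ
  valueOf-𝟎 = (λ (r , q<r , r⊑𝟎) → lift (ℚₚ.<-≤-trans q<r
      (const-reflects-≤ {r} {0ᵤ} (⊑-respʳ-≈ (≈-sym const-0ᵤ) r⊑𝟎)))) ,
    λ q<0 → 𝕀.negative (valueOf 𝟎) (lower q<0)

  valueOf-embedding : MVEmbedding (_/_ mvReduct filter) (standardMV (c ⊔ ℓ))
  valueOf-embedding = record
    { homomorphism = record
      { ⟦_⟧     = valueOf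
      ; ⟦⟧-cong = λ (x⊑y , y⊑x) → valueOf-mono x⊑y , valueOf-mono y⊑x
      ; ⊕-homo  = valueOf-⊕
      ; ∼-homo  = valueOf-∼
      ; 𝟎-homo  = valueOf-𝟎
      }
    ; injective = λ (x≤y , y≤x) → valueOf-reflects x≤y , valueOf-reflects y≤x
    }

  -- An arbitrary embedding is known only through the MV operations; its monotonicity and lower
  -- bounds for its values at constants are recovered from these.
  module Embedding (e : MVEmbedding (_/_ mvReduct filter) (standardMV (c ⊔ ℓ))) where
    open MVEmbedding e

    ⟦⟧-mono : ∀ {x y} → x ⊑ y → ⟦ x ⟧ ≤ᵢ ⟦ y ⟧
    ⟦⟧-mono {x} {y} x⊑y {q} q∈x =
      let r , q<r , r∈x = 𝕀.open-cut ⟦ x ⟧ q∈x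
      in proj₁ (⟦⟧-cong (join⊑y , ≤⇒⊑ (≤-respʳ-≈ (∨-comm x y) y≤x∨y)))
        (proj₂ (⊕-homo (∼ (y ⇒ x)) x)
          -- Modulo the filter `y` equals `∼ (y ⇒ x) ⊕ x`. The first summand contributes the
          -- negative number q - r, which belongs to every cut.
          (𝕀.bounded ⟦ x ⟧ q∈x , q - r , r ,
           𝕀.negative ⟦ ∼ (y ⇒ x) ⟧ (<-transport q<r
             (solve 2 (λ q r → r :- q := con 0ℚ :- (q :- r))
                refl q r)) ,
           r∈x , ℚₚ.≤-reflexive (solve 2 (λ q r → q := (q :- r) :+ r) refl q r)))
      where
      join⊑y : y ∨ x ⊑ y
      join⊑y = ⊑-respˡ-≈ (∨-comm x y) (⊑-respʳ-≈ (⊕-identityˡ y)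
        (⊕-monoˡ-⊑ (∈-resp-≈ (≈-sym (≈-trans (⇒𝟎≈∼ _) (∼-involutive _))) x⊑y)))

    cut-≤ : ∀ x {p q} → p ℚ.≤ q → q ∈ 𝕀.cut ⟦ x ⟧ → p ∈ 𝕀.cut ⟦ x ⟧
    cut-≤ x p≤q q∈x = let r , q<r , r∈x = 𝕀.open-cut ⟦ x ⟧ q∈x
                      in 𝕀.downward ⟦ x ⟧ (ℚₚ.≤-<-trans p≤q q<r) r∈x

    cut-halve : ∀ x {q} → q + q ∈ 𝕀.cut ⟦ x ⊕ x ⟧ → q ∈ 𝕀.cut ⟦ x ⟧
    cut-halve x {q} 2q∈ with proj₁ (⊕-homo x x) 2q∈
    ... | _ , a , b , a∈x , b∈x , 2q≤a+b with ℚₚ.≤-total q a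
    ...   | inj₁ q≤a = cut-≤ x q≤a a∈x
    ...   | inj₂ a≤q = cut-≤ x (≤-transport (ℚₚ.+-mono-≤ 2q≤a+b a≤q)
              (solve 3 (λ a b q → ((a :+ b) :+ q) :- ((q :+ q) :+ a) := b :- q) refl a b q)) b∈x

    ∈⇒full : ∀ {x q} → x ∈ filter → q ℚ.< 1ℚ → q ∈ 𝕀.cut ⟦ x ⟧
    ∈⇒full x∈F q<1 = ⟦⟧-mono {𝟏} (∈⇒⊑ x∈F) (proj₂ (∼-homo 𝟎) (1ℚ , q<1 ,
      λ 0∈ → ℚₚ.<-irrefl refl (lower (proj₁ 𝟎-homo 0∈))))

    ∼∈⇒empty : ∀ {x q} → ∼ x ∈ filter → q ∈ 𝕀.cut ⟦ x ⟧ → q ℚ.< 0ℚ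
    ∼∈⇒empty ∼x∈F q∈ = lower (proj₁ 𝟎-homo (⟦⟧-mono (∈-resp-≈ (≈-sym (⇒𝟎≈∼ _)) ∼x∈F) q∈))

    -- Binary expansion: `½ ⊕ ½ = 1` handles ½; a constant up to ½ is doubled, which also doubles
    -- the tolerance; a larger one is split as ½ plus a remainder up to ½.
    const-lower : ∀ r {q} → q ℚ.< value r → q ∈ 𝕀.cut ⟦ const r ⟧
    const-lower r {q} q<r = halving Bound large half
      (½-positive (positive-difference q<r)) r q
      (<-transport (½-positive (positive-difference q<r))
        (solve 2 (λ q r → con ½ :* (r :- q) :- con 0ℚ := r :- (q :+ con ½ :* (r :- q))) refl q (value r)))
      where
      Bound : ℚ → Set _
      Bound ε = ∀ r q → q + ε ℚ.< value r → q ∈ 𝕀.cut ⟦ const r ⟧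

      large : ∀ {ε} → 1ℚ ℚ.≤ ε → Bound ε
      large {ε} 1≤ε r q q+ε<r = 𝕀.negative ⟦ const r ⟧
        (<-transport (ℚₚ.+-mono-≤-< 1≤ε (ℚₚ.<-≤-trans q+ε<r (≤1 r)))
          (solve 2 (λ q ε → (ε :+ con 1ℚ) :- (con 1ℚ :+ (q :+ ε)) := con 0ℚ :- q) refl q ε))

      ½-lower : ∀ {q} → q ℚ.< ½ → q ∈ 𝕀.cut ⟦ const ½ᵤ ⟧
      ½-lower q<½ = cut-halve (const ½ᵤ) (∈⇒full (upward const-≥½⊕½ 𝟏∈) (ℚₚ.+-mono-< q<½ q<½))

      small : ∀ {ε} → Bound (ε + ε) → ∀ r q → value r ℚ.≤ ½ → q + ε ℚ.< value r → q ∈ 𝕀.cut ⟦ const r ⟧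
      small {ε} bound r q r≤½ q+ε<r = cut-halve (const r)
        (⟦⟧-mono (≤⇒⊑ (≤-reflexive (≈-sym (⊕-const r r))))
          (bound (r ⊕ᵤ r) (q + q) (ℚₚ.<-≤-trans
            (<-transport (ℚₚ.+-mono-< q+ε<r q+ε<r)
              (solve 3 (λ q r ε → (r :+ r) :- ((q :+ ε) :+ (q :+ ε)) := (r :+ r) :- ((q :+ q) :+ (ε :+ ε)))
                 refl q (value r) ε))
            (⊕ᵤ-lower r r ℚₚ.≤-refl (ℚₚ.+-mono-≤ r≤½ r≤½)))))

      half : ∀ {ε} → 0ℚ ℚ.< ε → Bound (ε + ε) → Bound ε
      half {ε} 0<ε bound r q q+ε<r with ℚₚ.≤-total (value r) ½
      ... | inj₁ r≤½ = small bound r q r≤½ q+ε<r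
      ... | inj₂ ½≤r = ⟦⟧-mono (⊑-respˡ-≈ (≈-sym (⊕-const ½ᵤ s)) (≤⇒⊑ (const-≤ {½ᵤ ⊕ᵤ s} {r} ½⊕s≤r)))
          (proj₂ (⊕-homo (const ½ᵤ) (const s))
            ( ℚₚ.<-≤-trans (ℚₚ.≤-<-trans q≤q+ε q+ε<r) (≤1 r)
            -- With δ half the slack between q + ε and r, the first part is strictly below ½ and the
            -- second, increased by ε, is strictly below r - ½.
            , ½ - δ , q - (½ - δ)
            , ½-lower (<-transport 0<δ (solve 1 (λ δ → δ :- con 0ℚ := con ½ :- (con ½ :- δ)) refl δ))
            , small bound s (q - (½ - δ))
                (≤-transport (≤1 r) (solve 1 (λ r → con 1ℚ :- r := con ½ :- (r :- con ½)) refl (value r)))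
                (<-transport 0<δ (solve 3 (λ q r ε → let δ = con ½ :* (r :- (q :+ ε)) in
                  δ :- con 0ℚ := (r :- con ½) :- ((q :- (con ½ :- δ)) :+ ε)) refl q (value r) ε))
            , ℚₚ.≤-reflexive (solve 2 (λ q δ → q := (con ½ :- δ) :+ (q :- (con ½ :- δ))) refl q δ)))
        where
        δ = ½ * (value r - (q + ε))
        0<δ = ½-positive (positive-difference q+ε<r)
        q≤q+ε : q ℚ.≤ q + ε
        q≤q+ε = ≤-transport (ℚₚ.<⇒≤ 0<ε) (solve 2 (λ q ε → ε :- con 0ℚ := (q :+ ε) :- q) refl q ε)
        s : UnitRational
        s = unit (value r - ½)
          (≤-transport ½≤r (solve 1 (λ r → r :- con ½ := (r :- con ½) :- con 0ℚ) refl (value r)))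
          (≤-transport (ℚₚ.+-mono-≤ (≤1 r) (0≤ ½ᵤ))
            (solve 1 (λ r → (con 1ℚ :+ con ½) :- (r :+ con 0ℚ) := con 1ℚ :- (r :- con ½))
               refl (value r)))
        ½⊕s≤r : value (½ᵤ ⊕ᵤ s) ℚ.≤ value r
        ½⊕s≤r = ℚₚ.≤-trans (⊕ᵤ-upper ½ᵤ s)
          (ℚₚ.≤-reflexive (solve 1 (λ r → con ½ :+ (r :- con ½) := r) refl (value r)))

-- Tense operators and their frames

dual : ∀ {c ℓ} → TensePavelkaAlgebra c ℓ → TensePavelkaAlgebra c ℓ
dual T = record
  { pavelka = pavelka
  ; G = H ; H = G
  ; G-cong = H-cong ; H-cong = G-cong
  ; PT1-G = PT1-H ; PT1-H = PT1-G
  ; PT2-G = PT2-H ; PT2-H = PT2-G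
  ; PT3-G = PT3-H ; PT3-H = PT3-G
  }
  where open TensePavelkaAlgebra T

module TenseOperator {c ℓ} (T : TensePavelkaAlgebra c ℓ) where
  open TensePavelkaAlgebra T
  open MVProperties mvReduct
  open PavelkaProperties pavelka

  Submultiplicative : Set _
  Submultiplicative = ∀ x y → G x · G y ≤ G (x · y)

  G-mono : ∀ {x y} → x ≤ y → G x ≤ G y
  G-mono {x} {y} x≤y = ≤-respˡ-≈ (≈-trans (≈-sym (PT1-G x y)) (G-cong x∧y≈x)) x∧y≤y
    where
    x∧y≈x : x ∧ y ≈ x
    x∧y≈x = ≤-antisym x∧y≤x (∧-glb ≤-refl x≤y)

  -- `PT2-G` at the constant 0, since `0 ⇒ x` is 1 for every `x`.
  G-𝟏 : G 𝟏 ≈ 𝟏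
  G-𝟏 = ≈-trans (G-cong (≈-sym (0⇒x≈𝟏 𝟏))) (≈-trans (≈-sym (PT2-G 0ᵤ 𝟏)) (0⇒x≈𝟏 (G 𝟏)))
    where
    0⇒x≈𝟏 : ∀ x → const 0ᵤ ⇒ x ≈ 𝟏
    0⇒x≈𝟏 x = ≤-respˡ-≈ (≈-sym const-0ᵤ) 𝟎≤x

  sq^-G : Submultiplicative → ∀ n a → sq^ n (G a) ≤ G (sq^ n a)
  sq^-G sub zero    a = ≤-refl
  sq^-G sub (suc n) a = ≤-trans (·-mono (sq^-G sub n a) (sq^-G sub n a)) (sub _ _)

module Frame (em : ∀ {ℓ} → ExcludedMiddle ℓ) {c ℓ} (T : TensePavelkaAlgebra c ℓ) where
  open Classical em
  open TensePavelkaAlgebra T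
  open MVProperties mvReduct
  open PavelkaProperties pavelka
  open TenseOperator T
  module At (F : SpecM mvReduct) = Spectrum em pavelka F

  infix 4 _∈ₛ_

  _∈ₛ_ : Carrier → SpecM mvReduct → Set _
  x ∈ₛ F = x ∈ SpecM.filter F

  -- R(F, F′) = 1
  Related : Rel (SpecM mvReduct) _
  Related F F′ = ∀ a → G a ∈ₛ F′ → a ∈ₛ F

  -- A form of R(F, F′) = 0 in which the infimum is attained.
  Unrelated : Rel (SpecM mvReduct) _
  Unrelated F F′ = ∃[ a ] (G a ∈ₛ F′ × ∼ a ∈ₛ F)

  Crisp : Set _
  Crisp = ∀ F F′ → Related F F′ ⊎ Unrelated F F′

  -- R(F, F′) ∈ {0, 1}, where vanishing means having no lower bound 1 - u > 0.
  Semicrisp : Set _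
  Semicrisp = ∀ F F′ → Related F F′ ⊎
    (∀ u → value u ℚ.< 1ℚ → ¬ (∀ a → G a ∈ₛ F′ → ∼ const u ⇒ a ∈ₛ F))

  crisp⇒semicrisp : Crisp → Semicrisp
  crisp⇒semicrisp crisp F F′ with crisp F F′
  ... | inj₁ related              = inj₁ related
  ... | inj₂ (a , Ga∈F′ , ∼a∈F) = inj₂ λ u u<1 bound →
    At.const∉ F u u<1 (At.∈-resp-≈ F (∼-involutive _) (At.∈-mp F (At.∼-anti-⊑ F (bound a Ga∈F′)) ∼a∈F))

  submultiplicative⇒crisp : Submultiplicative → Crisp
  submultiplicative⇒crisp sub F F′ with em {P = ∃[ a ] (G a ∈ₛ F′ × ¬ (a ∈ₛ F))}
  ... | no none = inj₁ λ a Ga∈F′ → dne λ a∉F → none (a , Ga∈F′ , a∉F)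
  ... | yes (a , Ga∈F′ , a∉F) =
    let n , ∼aⁿ∈F = At.archimedean F a∉F
    in inj₂ (sq^ n a , At.upward F′ (sq^-G sub n a) (At.sq^-closed F′ n Ga∈F′) , ∼aⁿ∈F)

  -- `PT2-G` moves the constant under `G`, so relatedness transfers all rational lower bounds and
  -- not just membership.
  related-const : ∀ {F F′} → Related F F′ → ∀ r a → const r ⇒ G a ∈ₛ F′ → const r ⇒ a ∈ₛ F
  related-const {F′ = F′} related r a r⊑Ga = related _ (At.∈-resp-≈ F′ (PT2-G r a) r⊑Ga)

  Crispᵈ : Set _
  Crispᵈ = ∀ F′ F → (∀ a → H a ∈ₛ F → a ∈ₛ F′) ⊎ (∃[ a ] (H a ∈ₛ F × ∼ a ∈ₛ F′))

  -- The frame of the dual algebra is the converse of the frame of T.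
  crisp⇒crispᵈ : Crisp → Crispᵈ
  crisp⇒crispᵈ crisp F′ F with crisp F F′
  -- `PT3-H` reads `∼ a ≤ H (∼ G a)`, so the negated value is a witness for the converse frame.
  ... | inj₂ (a , Ga∈F′ , ∼a∈F) = inj₂ (∼ G a ,
          At.upward F (≤-respʳ-≈ (∼-involutive _) (∼-anti (PT3-H a))) ∼a∈F ,
          At.∈-resp-≈ F′ (≈-sym (∼-involutive _)) Ga∈F′)
  ... | inj₁ related = inj₁ λ b Hb∈F → At.limit F′ λ u u<1 → dne λ u⋢b →
          -- If `b` is at most u at `F′`, then `∼ u ⊑ ∼ b ⊑ G (∼ H b)` there by `PT3-G`. Relatedness
          -- gives `∼ u ⊑ ∼ H b` at `F`, so `H b` in `F` would put the constant u < 1 into `F`.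
          let ∼u⊑G∼Hb = At.⊑-respˡ-≈ F′ (∼-const u) (At.⊑-trans F′ (At.∼-anti-⊑ F′ (At.⋢⇒⊒ F′ u⋢b))
                          (At.≤⇒⊑ F′ (≤-respʳ-≈ (∼-involutive _) (∼-anti (PT3-G b)))))
              ∼u⊑∼Hb  = related-const {F} {F′} related (∼ᵤ u) _ ∼u⊑G∼Hb
          in At.const∉ F (∼ᵤ ∼ᵤ u)
               (subst (ℚ._< 1ℚ) (solve 1 (λ u → u := con 1ℚ :- (con 1ℚ :- u)) refl (value u)) u<1)
               (At.∈-mp F (At.⊑-respʳ-≈ F (∼-const _)
                 (At.⊑-respˡ-≈ F (∼-involutive _) (At.∼-anti-⊑ F ∼u⊑∼Hb))) Hb∈F)

  module _ (ν : SpectralEmbedding T) where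
    module E (F : SpecM mvReduct) = At.Embedding F (ν F)

    private
      _⇒ᵢ_ : 𝕀 (c ⊔ ℓ) → 𝕀 (c ⊔ ℓ) → 𝕀 (c ⊔ ℓ)
      x ⇒ᵢ y = (∼ᵢ x) ⊕ᵢ y

      v : Carrier → SpecM mvReduct → 𝕀 (c ⊔ ℓ)
      v = valueAt T ν

    -- Residuation across two points, tested on rational bounds. In the sum of the bounds for `∼ x`
    -- and `y`, bracketing `x` costs at most ε and the two shifts by δ cost another ε; w - 2ε is
    -- exactly q.
    ⇒ᵢ-lower : ∀ F F′ x y w → (∀ r → const r ⇒ x ∈ₛ F′ → const (r ·ᵤ w) ⇒ y ∈ₛ F) →
               ∀ {q} → q ℚ.< value w → q ∈ 𝕀.cut (v x F′ ⇒ᵢ v y F)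
    ⇒ᵢ-lower F F′ x y w bound {q} q<w =
      let 0<w-q = positive-difference q<w
          ε = ½ * (value w - q)
          δ = ½ * ε
          r , s , r⊑x , x⊑s , s≤r+ε = At.bracket F′ x (½-positive 0<w-q)
          0<δ = ½-positive (½-positive 0<w-q)
      in ℚₚ.<-≤-trans q<w (≤1 w) ,
         (1ℚ - value s) - δ , ((value r + value w) - 1ℚ) - δ ,
         proj₁ (MVEmbedding.∼-homo (ν F′) x) (E.⟦⟧-mono F′
           (At.⊑-respˡ-≈ F′ (∼-const s) (At.∼-anti-⊑ F′ x⊑s))
           (E.const-lower F′ (∼ᵤ s) (p-δ<p (1ℚ - value s) 0<δ))) ,
         E.⟦⟧-mono F (bound r r⊑x)
           (E.const-lower F (r ·ᵤ w) (ℚₚ.<-≤-trans (p-δ<p _ 0<δ) (·ᵤ-lower r w))) ,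
         ≤-transport s≤r+ε (solve 4 (λ r s w q → let ε = con ½ :* (w :- q); δ = con ½ :* ε in
           (r :+ ε) :- s := (((con 1ℚ :- s) :- δ) :+ (((r :+ w) :- con 1ℚ) :- δ)) :- q)
           refl (value r) (value s) (value w) q)

    ∼ᵢ-full : ∀ {F x q} → x ∈ₛ F → q ∈ 𝕀.cut (∼ᵢ v x F) → q ℚ.< 0ℚ
    ∼ᵢ-full {F} x∈F (r , q<r , 1-r∉) = ℚₚ.<-≤-trans q<r (ℚₚ.≮⇒≥ λ 0<r →
      1-r∉ (E.∈⇒full F x∈F (<-transport 0<r (solve 1 (λ r → r :- con 0ℚ := con 1ℚ :- (con 1ℚ :- r)) refl r))))

    crisp⇒boolean : Crisp → IsBoolean (naturalTimeFrame T ν)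
    crisp⇒boolean crisp F F′ with crisp F F′
    ... | inj₁ related = inj₂
      ( (λ q∈R → 1ℚ , 𝕀.bounded (TimeFrame.R (naturalTimeFrame T ν) F F′) q∈R ,
          λ 0<0 → ℚₚ.<-irrefl refl (lower 0<0))
      , λ q∈𝟏 → let m , q<m , m<1 = ℚₚ.<-dense (𝕀.bounded (∼ᵢ 0ᵢ) q∈𝟏)
                in m , q<m , ℚₚ.<⇒≤ m<1 , λ (lift a) → ⇒ᵢ-lower F F′ (G a) a 1ᵤ
                     (λ r r⊑Ga → At.⊑-trans F (At.≤⇒⊑ F (≤-respˡ-≈ (·-const r 1ᵤ) x·y≤x))
                       (related-const {F} {F′} related r a r⊑Ga)) m<1 )
    ... | inj₂ (a , Ga∈F′ , ∼a∈F) = inj₁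
      ( (λ (r , q<r , _ , r∈) →
          -- At the witness both `∼ G a` and `a` have value 0, so both summands are negative.
          let _ , p , q , p∈ , q∈ , r≤p+q = r∈ (lift a)
          in lift (ℚₚ.<-trans q<r (ℚₚ.≤-<-trans r≤p+q
               (ℚₚ.+-mono-< (∼ᵢ-full {F′} Ga∈F′ p∈) (E.∼∈⇒empty F ∼a∈F q∈)))))
      , λ q<0 → 𝕀.negative (TimeFrame.R (naturalTimeFrame T ν) F F′) (lower q<0) )

  canonical : SpectralEmbedding T
  canonical F = At.valueOf-embedding F

  boolean⇒semicrisp : IsBoolean (naturalTimeFrame T canonical) → Semicrisp
  boolean⇒semicrisp boolean F F′ with boolean F F′
  ... | inj₁ (R≤𝟎 , _) = inj₂ λ u u<1 bound →
    let 0<d = ½-positive (positive-difference u<1)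
    -- The assumed bound makes 1 - u a lower bound of R; half of it witnesses that 0 lies in the cut
    -- of R, contradicting R = 0.
    in ℚₚ.<-irrefl refl (lower (R≤𝟎 {0ℚ} (½ * (1ℚ - value u) , 0<d ,
      ℚₚ.≤-trans (ℚₚ.<⇒≤ (½d<d u u<1)) (≤1 (∼ᵤ u)) ,
      λ (lift a) → ⇒ᵢ-lower canonical F F′ (G a) a (∼ᵤ u)
        (λ r r⊑Ga → At.⊑-respˡ-≈ F
          (≈-trans (·-comm _ _) (≈-trans (·-cong ≈-refl (∼-const u)) (·-const r (∼ᵤ u))))
          -- The bound speaks only of elements whose `G` lies in `F′`; `PT2-G` makes `const r ⇒ a`
          -- such an element.
          (At.uncurry⊑ F (bound (const r ⇒ a) (At.∈-resp-≈ F′ (PT2-G r a) r⊑Ga))))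
        (½d<d u u<1))))
    where
    ½d<d : ∀ u → value u ℚ.< 1ℚ → ½ * (1ℚ - value u) ℚ.< 1ℚ - value u
    ½d<d u u<1 = <-transport (½-positive (positive-difference u<1))
      (solve 1 (λ u → let d = con 1ℚ :- u in con ½ :* d :- con 0ℚ := d :- con ½ :* d) refl (value u))
  ... | inj₂ (_ , 𝟏≤R) = inj₁ λ a Ga∈F′ → At.limit F λ u u<1 →
    let r , u<r , _ , r∈ = 𝟏≤R (1ℚ , u<1 , λ 0<0 → ℚₚ.<-irrefl refl (lower 0<0))
        _ , p , q , p∈ , (s , q<s , s⊑a) , r≤p+q = r∈ (lift a)
        u<s = ℚₚ.<-trans u<r (ℚₚ.≤-<-trans r≤p+q
          (subst (p + q ℚ.<_) (ℚₚ.+-identityˡ (value s)) (ℚₚ.+-mono-< (∼ᵢ-full canonical {F′} Ga∈F′ p∈) q<s)))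
    in At.⊑-trans F (At.≤⇒⊑ F (const-≤ (ℚₚ.<⇒≤ u<s))) s⊑a

-- `G` as a box operator over the maximal spectrum

module Representation (em : ∀ {ℓ} → ExcludedMiddle ℓ) (zorn : ∀ {c ℓ₁ ℓ₂ p} → ZornsLemma c ℓ₁ ℓ₂ p)
                      {c ℓ i s t} (T : TensePavelkaAlgebra c ℓ)
                      (semisimple : IsSemisimple i s t (TensePavelkaAlgebra.mvReduct T)) where
  open Classical em
  open TensePavelkaAlgebra T
  open MVProperties mvReduct
  open PavelkaProperties pavelka
  open TenseOperator T
  open Frame em T

  module _ (semicrisp : Semicrisp) where

    -- If const u ⇒ G y ∉ F′ then the elements (a ⇒ y) ⇒ const u with G a ∈ F′ generate a
    -- proper filter.  A maximal filter F above them satisfies a/F ≥ y/F + (1 - u) without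
    -- truncation whenever G a ∈ F′, so R(F, F′) ≥ 1 - u > 0, while a = 1 gives y ∉ F.
    related-counterexample : ∀ {y} F′ → ¬ (G y ∈ₛ F′) → ∃[ F ] (Related F F′ × ¬ (y ∈ₛ F))
    related-counterexample {y} F′ Gy∉F′ = F , related , λ y∈F →
      At.const∉ F u u<1 (At.∈-mp F (bound 𝟏 G𝟏∈F′) (At.∈⇒⊑ F y∈F))
      where
      gap : ∃[ u ] (value u ℚ.< 1ℚ × ¬ (const u ⇒ G y ∈ₛ F′))
      gap = dne λ none → Gy∉F′ (At.limit F′ λ u u<1 → dne λ u⋢Gy → none (u , u<1 , u⋢Gy))
      u = proj₁ gap
      u<1 = proj₁ (proj₂ gap)

      G𝟏∈F′ : G 𝟏 ∈ₛ F′
      G𝟏∈F′ = At.≈𝟏⇒∈ F′ G-𝟏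

      d : Carrier → Carrier
      d a = (a ⇒ y) ⇒ const u

      d-mono : ∀ {a b} → a ≤ b → d a ≤ d b
      d-mono a≤b = ⇒-mono (⇒-mono a≤b ≤-refl) ≤-refl

      D : Pred Carrier (c ⊔ ℓ)
      D x = ∃[ a ] (G a ∈ₛ F′ × x ≈ d a)
      open Generated mvReduct D

      meet∈ : ∀ {a b} → G a ∈ₛ F′ → G b ∈ₛ F′ → G (a ∧ b) ∈ₛ F′
      meet∈ {a} {b} Ga∈F′ Gb∈F′ = At.upward F′
        (≤-respʳ-≈ (≈-sym (PT1-G a b)) (∧-glb x·y≤x x·y≤y)) (At.·-closed F′ Ga∈F′ Gb∈F′)

      isProper : IsProperFilter mvReduct Gen
      isProper = record
        { isFilter = Gen-isFilter (_ , 𝟏 , G𝟏∈F′ , ≈-refl)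
            λ (a , Ga∈F′ , p) (b , Gb∈F′ , q) → d (a ∧ b) , (a ∧ b , meet∈ Ga∈F′ Gb∈F′ , ≈-refl) ,
              ≤-respʳ-≈ (≈-sym p) (d-mono x∧y≤x) , ≤-respʳ-≈ (≈-sym q) (d-mono x∧y≤y)
        ; proper = λ (x , (a , Ga∈F′ , x≈da) , n , xⁿ≤𝟎) →
            -- Prelinearity survives squaring of `d a`. If a power of `d a` vanishes, the other
            -- disjunct `u ⇒ (a ⇒ y)` is 1, hence `a ≤ u ⇒ y`, and applying `G` contradicts the
            -- choice of u.
            let daⁿ≤𝟎 = ≤-trans (sq^-mono n (≤-reflexive (≈-sym x≈da))) xⁿ≤𝟎
                𝟏≤u⇒a⇒y = ≤-respˡ-≈ (∨-≈𝟏-sq^ n (prelinear (a ⇒ y) (const u)))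
                             (∨-lub (≤-trans daⁿ≤𝟎 𝟎≤x) ≤-refl)
                a≤u⇒y = ≈-trans (⊕-swap (∼ a) (∼ const u) y) (𝟏≤x⇒x≈𝟏 𝟏≤u⇒a⇒y)
            in proj₂ (proj₂ gap) (At.∈-resp-≈ F′ (≈-sym (PT2-G u y))
                 (At.upward F′ (G-mono a≤u⇒y) Ga∈F′))
        }

      extension = maximalFilterAbove mvReduct zorn Gen isProper
      F = proj₁ extension

      bound : ∀ a → G a ∈ₛ F′ → d a ∈ₛ F
      bound a Ga∈F′ = proj₂ extension (D⊆Gen (a , Ga∈F′ , ≈-refl))

      ∼u⊑a : ∀ a → G a ∈ₛ F′ → ∼ const u ⇒ a ∈ₛ F
      ∼u⊑a a Ga∈F′ = At.⊑-trans F (At.∼-anti-⊑ F (bound a Ga∈F′))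
        (At.≤⇒⊑ F (≤-respʳ-≈ (∼-involutive a) (∼-anti ∼x≤x⇒y)))

      related : Related F F′
      related = [ id , (λ unrelated → ⊥-elim (unrelated u u<1 ∼u⊑a)) ]′ (semicrisp F F′)

    G-∈ : ∀ {y} F′ → (∀ F → Related F F′ → y ∈ₛ F) → G y ∈ₛ F′
    G-∈ F′ y∈ = dne λ Gy∉F′ →
      let F , related , y∉F = related-counterexample F′ Gy∉F′ in y∉F (y∈ F related)

    const-⊑-G : ∀ q {y} F′ → (∀ F → Related F F′ → const q ⇒ y ∈ₛ F) → const q ⇒ G y ∈ₛ F′
    const-⊑-G q F′ q⊑y = At.∈-resp-≈ F′ (≈-sym (PT2-G q _)) (G-∈ F′ q⊑y)

    ≤-fromSpectrum : ∀ {x y} → (∀ F → x ⇒ y ∈ₛ F) → x ≤ y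
    ≤-fromSpectrum = spectrum-separates mvReduct semisimple

    -- After currying, `G x` and `G y` are replaced by constants. `PT2-G` takes these under `G`, and
    -- at each related point they bound `x` and `y`, so their product bounds `x · y`.
    G-· : ∀ x y → G x · G y ≤ G (x · y)
    G-· x y = ≤-fromSpectrum λ F′ → At.uncurry⊑ F′ (At.approximate F′ λ r q r⊑Gx q<r →
      At.∈-resp-≈ F′ (⊕-swap _ _ _) (At.approximate F′ λ r′ q′ r′⊑Gy q′<r′ →
        At.⊑-respʳ-≈ F′ (≈-sym (PT2-G q _)) (const-⊑-G q′ F′ λ F related →
          At.curry⊑ F (At.⊑-respˡ-≈ F (·-comm _ _) (At.·-mono-⊑ F
            (lower-const F F′ related r⊑Gx q<r) (lower-const F F′ related r′⊑Gy q′<r′))))))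
      where
      lower-const : ∀ F F′ → Related F F′ → ∀ {r q x} → const r ⇒ G x ∈ₛ F′ → value q ℚ.< value r →
                    const q ⇒ x ∈ₛ F
      lower-const F F′ related {r} {q} r⊑Gx q<r =
        At.⊑-trans F (At.≤⇒⊑ F (const-≤ (ℚₚ.<⇒≤ q<r))) (related-const {F} {F′} related r _ r⊑Gx)

    G-⊕ : ∀ x y → G x ⊕ G y ≤ G (x ⊕ y)
    G-⊕ x y = ≤-fromSpectrum λ F′ → At.approximate F′ λ t q t⊑Gx⊕Gy q<t →
      let r , s , r⊑Gx , s⊑Gy , q<r+s = At.⊕-split F′ t⊑Gx⊕Gy q<t
      in const-⊑-G q F′ λ F related → At.⊑-trans F
           (At.≤⇒⊑ F (≤-respʳ-≈ (≈-sym (⊕-const r s)) (const-≤ (⊕ᵤ-lower r s (ℚₚ.<⇒≤ q<r+s) (≤1 q)))))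
           (At.⊕-mono-⊑ F (related-const {F} {F′} related r x r⊑Gx) (related-const {F} {F′} related s y s⊑Gy))

    -- (1 + q)/2 squares to q
    G-square : ∀ x → G x · G x ≈ G (x · x)
    G-square x = ≤-antisym (G-· x x) (≤-fromSpectrum λ F′ → At.approximate F′ λ r q r⊑Gx² q<r →
      let m   = mean 1ᵤ q
          -- At a related point where `x` is at most m, the square of `x` is at most that of m,
          -- which is q < r, against the lower bound r.
          m⊑Gx = const-⊑-G m F′ λ F related → dne λ m⋢x →
            let r⊑m² = At.⊑-trans F (related-const {F} {F′} related r _ r⊑Gx²)
                         (At.⊑-respʳ-≈ F (·-const m m) (At.·-mono-⊑ F (At.⋢⇒⊒ F m⋢x) (At.⋢⇒⊒ F m⋢x)))
            in ℚₚ.<-irrefl refl (ℚₚ.<-≤-trans q<r (ℚₚ.≤-trans (At.const-reflects-≤ F {r} {m ·ᵤ m} r⊑m²)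
                 (·ᵤ-upper m m (0≤ q) (ℚₚ.≤-reflexive (≡.sym (square q))))))
      in At.⊑-trans F′ (At.≤⇒⊑ F′ (≤-respʳ-≈ (≈-sym (·-const m m))
           (const-≤ {q} {m ·ᵤ m} (ℚₚ.≤-trans (ℚₚ.≤-reflexive (square q)) (·ᵤ-lower m m)))))
           (At.·-mono-⊑ F′ m⊑Gx m⊑Gx))
      where
      square : ∀ q → value q ≡ (value (mean 1ᵤ q) + value (mean 1ᵤ q)) - 1ℚ
      square q = solve 1 (λ q → let m = con ½ :* (con 1ℚ :+ q) in q := (m :+ m) :- con 1ℚ) refl (value q)

    -- The nontrivial inequality uses m = q/2: a related point with `x` at most m would give `x ⊕ x`
    -- at most q < r.
    G-double : ∀ x → G x ⊕ G x ≈ G (x ⊕ x)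
    G-double x = ≤-antisym (G-⊕ x x) (≤-fromSpectrum λ F′ → At.approximate F′ λ r q r⊑G2x q<r →
      let m   = mean 0ᵤ q
          m⊑Gx = const-⊑-G m F′ λ F related → dne λ m⋢x →
            let r⊑2m = At.⊑-trans F (related-const {F} {F′} related r _ r⊑G2x)
                         (At.⊑-respʳ-≈ F (⊕-const m m) (At.⊕-mono-⊑ F (At.⋢⇒⊒ F m⋢x) (At.⋢⇒⊒ F m⋢x)))
            in ℚₚ.<-irrefl refl (ℚₚ.<-≤-trans q<r (ℚₚ.≤-trans (At.const-reflects-≤ F {r} {m ⊕ᵤ m} r⊑2m)
                 (ℚₚ.≤-trans (⊕ᵤ-upper m m) (ℚₚ.≤-reflexive (≡.sym (double q))))))
      in At.⊑-trans F′ (At.≤⇒⊑ F′ (≤-respʳ-≈ (≈-sym (⊕-const m m))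
           (const-≤ {q} {m ⊕ᵤ m} (⊕ᵤ-lower m m (ℚₚ.≤-reflexive (double q)) (≤1 q)))))
           (At.⊕-mono-⊑ F′ m⊑Gx m⊑Gx))
      where
      double : ∀ q → value q ≡ value (mean 0ᵤ q) + value (mean 0ᵤ q)
      double q = solve 1 (λ q → let m = con ½ :* (con 0ℚ :+ q) in q := m :+ m) refl (value q)

-- Assembling the equivalences

module Equivalences (em : ∀ {ℓ} → ExcludedMiddle ℓ) (zorn : ∀ {c ℓ₁ ℓ₂ p} → ZornsLemma c ℓ₁ ℓ₂ p)
                    {c ℓ i s t} (T : TensePavelkaAlgebra c ℓ)
                    (semisimple : IsSemisimple i s t (TensePavelkaAlgebra.mvReduct T)) where
  open TensePavelkaAlgebra T
  open TenseOperator T using (Submultiplicative)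
  open Frame em T

  private
    module Rep  = Representation em zorn T semisimple
    module Repᵈ = Representation em zorn (dual T) semisimple

  crispᵈ : Submultiplicative → Frame.Crisp em (dual T)
  crispᵈ = crisp⇒crispᵈ ∘ submultiplicative⇒crisp

  submultiplicativeᵈ : Submultiplicative → TenseOperator.Submultiplicative (dual T)
  submultiplicativeᵈ = Repᵈ.G-· ∘ Frame.crisp⇒semicrisp em (dual T) ∘ crispᵈ

  boolean : Submultiplicative → ∀ ν → IsBoolean (naturalTimeFrame T ν)
  boolean sub ν = crisp⇒boolean ν (submultiplicative⇒crisp sub)

  fromBoolean : (∀ ν → IsBoolean (naturalTimeFrame T ν)) → Submultiplicative
  fromBoolean bool = Rep.G-· (boolean⇒semicrisp (bool canonical))

  isTenseMV : Submultiplicative → IsTenseMV mvReduct G H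
  isTenseMV sub = record
    { T1-G = TenseOperator.G-𝟏 T
    ; T1-H = TenseOperator.G-𝟏 (dual T)
    ; T2-G = sub
    ; T2-H = Repᵈ.G-· semiᵈ
    ; T3-G = Rep.G-⊕ semi
    ; T3-H = Repᵈ.G-⊕ semiᵈ
    ; T4-G = Rep.G-square semi
    ; T4-H = Repᵈ.G-square semiᵈ
    ; T5-G = Rep.G-double semi
    ; T5-H = Repᵈ.G-double semiᵈ
    ; T6-G = PT3-G
    ; T6-H = PT3-H
    }
    where
    semi  = crisp⇒semicrisp (submultiplicative⇒crisp sub)
    semiᵈ = Frame.crisp⇒semicrisp em (dual T) (crispᵈ sub)

theorem12 :
    (∀ {ℓ} → ExcludedMiddle ℓ) →
    (∀ {c ℓ₁ ℓ₂ p} → ZornsLemma c ℓ₁ ℓ₂ p) →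
    ∀ {c ℓ i s t} (T : TensePavelkaAlgebra c ℓ) →
    let open TensePavelkaAlgebra T in
    IsSemisimple i s t mvReduct →
    let cond-i   = ∀ x y → G x · G y ≤ G (x · y)
        cond-ii  = ∀ x y → H x · H y ≤ H (x · y)
        cond-iii = (ν : SpectralEmbedding T) → IsBoolean (naturalTimeFrame T ν)
        cond-iv  = IsTenseMV mvReduct G H
    in (cond-i ⇔ cond-ii) × (cond-i ⇔ cond-iii) × (cond-i ⇔ cond-iv)
theorem12 em zorn T semisimple =
  -- The operators of `dual (dual T)` compute to those of `T`, so one implication serves both
  -- directions.
  mk⇔ submultiplicativeᵈ (Equivalences.submultiplicativeᵈ em zorn (dual T) semisimple) ,
  mk⇔ boolean fromBoolean ,
  mk⇔ isTenseMV IsTenseMV.T2-G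
  where open Equivalences em zorn T semisimple
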